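{- The competitive ratios of IncMax and IncMaxSep coincide.
   Context: IncMax. An instance is given by a countable set $U$ of elements and a monotone function $f:2^U\to\mathbb{R}_{\ge 0}$ (i.e. $f(X)\le f(Y)$ for $X\subseteq Y$) that is accountable: for every (finite non-empty) $X\subseteq U$ there exists $e\in X$ with $f(X\setminus\{e\})\ge f(X)-f(X)/|X|$. For $k\le n:=|U|$ (all $k\in\mathbb{N}$ if $U$ is infinite) let $\mathrm{Opt}(k)=\max\{f(X): X\subseteq U,\ |X|=k\}$ (assumed to exist). A deterministic solution is an order $\sigma=(e_1,e_2,\dots)$ of the elements of $U$; it is $\alpha$-competitive ($\alpha\ge1$) if $\mathrm{Opt}(k)\le\alpha\, f(\{e_1,\dots,e_k\})$ for all $k$. An algorithm is $\alpha$-competitive for a class of instances if it produces an $\alpha$-competitive solution for every instance of the class; the competitive ratio of an algorithm is the infimum over all such $\alpha$, and the competitive ratio of a class of instances is the infimum over the competitive ratios of all (deterministic, computationally unrestricted) algorithms for it. IncMaxSep is the restriction of IncMax to separable instances: an instance with objective $f$ is separable if there are a (finite or countable) partition $U=R_1\cup R_2\cup\dots$ and values $d_i>0$ with $f(X)=\max_{i}\{|X\cap R_i|\cdot d_i\}$ for all $X\subseteq U$. -}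

module Defs where

open import Data.Empty.Polymorphic using (⊥)
open import Data.Fin.Base using (Fin; toℕ; inject≤)
open import Data.Fin.Properties using (toℕ-injective; inject≤-injective)
open import Data.Integer.Base using (+_)
open import Data.List.Base using (List; []; _∷_; length; filter; tabulate)
open import Data.List.Membership.Propositional using (_∈_)
open import Data.List.Relation.Binary.Subset.Propositional using () renaming (_⊆_ to _⊆ᴸ_)
open import Data.List.Relation.Unary.All as All using (All; []; _∷_)
open import Data.List.Relation.Unary.AllPairs using ([]; _∷_)
open import Data.List.Relation.Unary.Any using (here; there; _─_)
open import Data.List.Relation.Unary.Unique.Propositional using (Unique)
open import Data.List.Relation.Unary.Unique.Propositional.Properties using (tabulate⁺)
open import Data.Nat.Base as ℕ using (ℕ; NonZero)
import Data.Nat.Properties as ℕ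
open import Data.Product.Base using (Σ-syntax; ∃-syntax; _×_; _,_; proj₁; proj₂)
open import Data.Rational.Base as ℚ using (ℚ; 0ℚ; 1ℚ; Positive; ∣_∣)
import Data.Rational.Properties as ℚ
open import Data.Rational.Solver using (module +-*-Solver)
open import Function.Bundles using (_⤖_; module Bijection)
open import Level using (0ℓ) renaming (suc to lsuc)
open import Relation.Binary.Construct.Add.Supremum.NonStrict as Sup using ([_]; _≤⊤⁺)
open import Relation.Binary.PropositionalEquality.Core using (_≡_; refl; sym; trans; cong; cong₂; subst)
open import Relation.Nullary.Construct.Add.Supremum using (_⁺; [_]; ⊤⁺)
open import Relation.Unary using (Pred; U)

------------------------------------------------------------------------
-- Real numbers: Cauchy sequences of rationals, with equality `_≈_`.

record ℝ : Set where
  constructor mkℝ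
  field
    seq    : ℕ → ℚ
    cauchy : ∀ ε → 0ℚ ℚ.< ε →
             ∃[ N ] ∀ m n → N ℕ.≤ m → N ℕ.≤ n → ∣ seq m ℚ.- seq n ∣ ℚ.< ε

open ℝ public

infix  4 _≤_ _<_ _≈_
infixl 6 _-_
infixl 7 _*_ _÷_

_≤_ : ℝ → ℝ → Set
x ≤ y = ∀ ε → 0ℚ ℚ.< ε → ∃[ N ] ∀ n → N ℕ.≤ n → seq x n ℚ.≤ seq y n ℚ.+ ε

_<_ : ℝ → ℝ → Set
x < y = ∃[ ε ] 0ℚ ℚ.< ε × ∃[ N ] ∀ n → N ℕ.≤ n → seq x n ℚ.+ ε ℚ.≤ seq y n

_≈_ : ℝ → ℝ → Set
x ≈ y = x ≤ y × y ≤ x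

fromℚ : ℚ → ℝ
fromℚ p = mkℝ (λ _ → p) λ ε 0<ε → 0 , λ _ _ _ _ →
  subst (λ z → ∣ z ∣ ℚ.< ε) (sym (ℚ.+-inverseʳ p)) 0<ε

fromℕ : ℕ → ℝ
fromℕ n = fromℚ (+ n ℚ./ 1)

0ℝ 1ℝ : ℝ
0ℝ = fromℚ 0ℚ
1ℝ = fromℚ 1ℚ

private
  half : ℚ → ℚ
  half ε = ε ℚ.* ℚ.½

  half-pos : ∀ {ε} → 0ℚ ℚ.< ε → 0ℚ ℚ.< half ε
  half-pos {ε} 0<ε = ℚ.*-monoˡ-<-pos ℚ.½ 0<ε

  half+half : ∀ ε → half ε ℚ.+ half ε ≡ ε
  half+half ε = trans (sym (ℚ.*-distribˡ-+ ε ℚ.½ ℚ.½)) (ℚ.*-identityʳ ε)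

  -- A bound on a tail of the sequence.
  bounded : ∀ x → ∃[ B ] 0ℚ ℚ.< B × ∃[ N ] ∀ n → N ℕ.≤ n → ∣ seq x n ∣ ℚ.≤ B
  bounded x = 1ℚ ℚ.+ ∣ xN ∣ , 0<B , N , bound
    where
    N  = proj₁ (cauchy x 1ℚ (ℚ.positive⁻¹ 1ℚ))
    xN = seq x N
    0<B : 0ℚ ℚ.< 1ℚ ℚ.+ ∣ xN ∣
    0<B = ℚ.+-mono-<-≤ (ℚ.positive⁻¹ 1ℚ) (ℚ.0≤∣p∣ xN)
    bound : ∀ n → N ℕ.≤ n → ∣ seq x n ∣ ℚ.≤ 1ℚ ℚ.+ ∣ xN ∣
    bound n N≤n = begin
      ∣ seq x n ∣                      ≡⟨ cong ∣_∣ (solve 2 (λ a b → a := (a :- b) :+ b) refl (seq x n) xN) ⟩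
      ∣ (seq x n ℚ.- xN) ℚ.+ xN ∣      ≤⟨ ℚ.∣p+q∣≤∣p∣+∣q∣ (seq x n ℚ.- xN) xN ⟩
      ∣ seq x n ℚ.- xN ∣ ℚ.+ ∣ xN ∣    ≤⟨ ℚ.+-monoˡ-≤ ∣ xN ∣ (ℚ.<⇒≤ (proj₂ (cauchy x 1ℚ (ℚ.positive⁻¹ 1ℚ)) n N N≤n ℕ.≤-refl)) ⟩
      1ℚ ℚ.+ ∣ xN ∣                    ∎
      where open ℚ.≤-Reasoning
            open +-*-Solver

  -- For B > 0 and ε > 0 there is δ > 0 with B δ = ε.
  divide : ∀ B ε → 0ℚ ℚ.< B → 0ℚ ℚ.< ε → ∃[ δ ] 0ℚ ℚ.< δ × B ℚ.* δ ≡ ε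
  divide B ε 0<B 0<ε = 1/B ℚ.* ε , 0<δ , B*δ≡ε
    where
    instance
      posB : Positive B
      posB = ℚ.positive 0<B
      nzB : ℚ.NonZero B
      nzB = ℚ.pos⇒nonZero B
    1/B : ℚ
    1/B = ℚ.1/ B
    instance
      pos1/B : Positive 1/B
      pos1/B = ℚ.1/pos⇒pos B
    0<δ : 0ℚ ℚ.< 1/B ℚ.* ε
    0<δ = subst (ℚ._< 1/B ℚ.* ε) (ℚ.*-zeroʳ 1/B) (ℚ.*-monoʳ-<-pos 1/B 0<ε)
    B*δ≡ε : B ℚ.* (1/B ℚ.* ε) ≡ ε
    B*δ≡ε = trans (sym (ℚ.*-assoc B 1/B ε))
              (trans (cong (ℚ._* ε) (ℚ.*-inverseʳ B)) (ℚ.*-identityˡ ε))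

_-_ : ℝ → ℝ → ℝ
x - y = mkℝ (λ n → seq x n ℚ.- seq y n) λ ε 0<ε →
  let Nx , hx = cauchy x (half ε) (half-pos 0<ε)
      Ny , hy = cauchy y (half ε) (half-pos 0<ε)
  in Nx ℕ.⊔ Ny , λ m n N≤m N≤n → begin-strict
       ∣ (seq x m ℚ.- seq y m) ℚ.- (seq x n ℚ.- seq y n) ∣
         ≡⟨ cong ∣_∣ (solve 4 (λ a b c d → (a :- b) :- (c :- d) := (a :- c) :- (b :- d)) refl
              (seq x m) (seq y m) (seq x n) (seq y n)) ⟩
       ∣ (seq x m ℚ.- seq x n) ℚ.- (seq y m ℚ.- seq y n) ∣
         ≤⟨ ℚ.∣p-q∣≤∣p∣+∣q∣ (seq x m ℚ.- seq x n) (seq y m ℚ.- seq y n) ⟩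
       ∣ seq x m ℚ.- seq x n ∣ ℚ.+ ∣ seq y m ℚ.- seq y n ∣
         <⟨ ℚ.+-mono-< (hx m n (ℕ.m⊔n≤o⇒m≤o Nx Ny N≤m) (ℕ.m⊔n≤o⇒m≤o Nx Ny N≤n))
                       (hy m n (ℕ.m⊔n≤o⇒n≤o Nx Ny N≤m) (ℕ.m⊔n≤o⇒n≤o Nx Ny N≤n)) ⟩
       half ε ℚ.+ half ε
         ≡⟨ half+half ε ⟩
       ε ∎
  where open ℚ.≤-Reasoning
        open +-*-Solver

private
  scaled : ∀ a b c B δ → ∣ a ∣ ℚ.≤ B → ∣ b ℚ.- c ∣ ℚ.< δ → ∣ a ℚ.* (b ℚ.- c) ∣ ℚ.≤ B ℚ.* δ
  scaled a b c B δ a≤B bc<δ = begin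
    ∣ a ℚ.* (b ℚ.- c) ∣      ≡⟨ ℚ.∣p*q∣≡∣p∣*∣q∣ a (b ℚ.- c) ⟩
    ∣ a ∣ ℚ.* ∣ b ℚ.- c ∣    ≤⟨ ℚ.*-monoʳ-≤-nonNeg ∣ b ℚ.- c ∣ {{ℚ.nonNegative (ℚ.0≤∣p∣ (b ℚ.- c))}} a≤B ⟩
    B ℚ.* ∣ b ℚ.- c ∣        ≤⟨ ℚ.*-monoˡ-≤-nonNeg B {{ℚ.nonNegative (ℚ.≤-trans (ℚ.0≤∣p∣ a) a≤B)}} (ℚ.<⇒≤ bc<δ) ⟩
    B ℚ.* δ                  ∎
    where open ℚ.≤-Reasoning

_*_ : ℝ → ℝ → ℝ
x * y = mkℝ (λ n → seq x n ℚ.* seq y n) λ ε 0<ε →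
  let Bx , 0<Bx , Kx , bx = bounded x
      By , 0<By , Ky , by = bounded y
      η                   = half (half ε)
      0<η                 = half-pos (half-pos 0<ε)
      δy , 0<δy , eqy     = divide Bx η 0<Bx 0<η
      δx , 0<δx , eqx     = divide By η 0<By 0<η
      Nx , hx             = cauchy x δx 0<δx
      Ny , hy             = cauchy y δy 0<δy
      K                   = Kx ℕ.⊔ Ky
      N                   = Nx ℕ.⊔ Ny
  in K ℕ.⊔ N , λ m n KN≤m KN≤n →
     let K≤m = ℕ.m⊔n≤o⇒m≤o K N KN≤m
         N≤m = ℕ.m⊔n≤o⇒n≤o K N KN≤m
         K≤n = ℕ.m⊔n≤o⇒m≤o K N KN≤n
         N≤n = ℕ.m⊔n≤o⇒n≤o K N KN≤n
     in begin-strict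
       ∣ seq x m ℚ.* seq y m ℚ.- seq x n ℚ.* seq y n ∣
         ≡⟨ cong ∣_∣ (solve 4 (λ a b c d → a :* b :- c :* d := a :* (b :- d) :+ d :* (a :- c)) refl
              (seq x m) (seq y m) (seq x n) (seq y n)) ⟩
       ∣ seq x m ℚ.* (seq y m ℚ.- seq y n) ℚ.+ seq y n ℚ.* (seq x m ℚ.- seq x n) ∣
         ≤⟨ ℚ.∣p+q∣≤∣p∣+∣q∣ (seq x m ℚ.* (seq y m ℚ.- seq y n)) (seq y n ℚ.* (seq x m ℚ.- seq x n)) ⟩
       ∣ seq x m ℚ.* (seq y m ℚ.- seq y n) ∣ ℚ.+ ∣ seq y n ℚ.* (seq x m ℚ.- seq x n) ∣
         ≤⟨ ℚ.+-mono-≤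
              (scaled (seq x m) (seq y m) (seq y n) Bx δy (bx m (ℕ.m⊔n≤o⇒m≤o Kx Ky K≤m))
                (hy m n (ℕ.m⊔n≤o⇒n≤o Nx Ny N≤m) (ℕ.m⊔n≤o⇒n≤o Nx Ny N≤n)))
              (scaled (seq y n) (seq x m) (seq x n) By δx (by n (ℕ.m⊔n≤o⇒n≤o Kx Ky K≤n))
                (hx m n (ℕ.m⊔n≤o⇒m≤o Nx Ny N≤m) (ℕ.m⊔n≤o⇒m≤o Nx Ny N≤n))) ⟩
       Bx ℚ.* δy ℚ.+ By ℚ.* δx
         ≡⟨ trans (cong₂ ℚ._+_ eqy eqx) (half+half (half ε)) ⟩
       half ε
         ≡⟨ ℚ.+-identityˡ (half ε) ⟨
       0ℚ ℚ.+ half ε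
         <⟨ ℚ.+-monoˡ-< (half ε) (half-pos 0<ε) ⟩
       half ε ℚ.+ half ε
         ≡⟨ half+half ε ⟩
       ε ∎
  where open ℚ.≤-Reasoning
        open +-*-Solver

_÷_ : ℝ → (n : ℕ) .{{_ : NonZero n}} → ℝ
x ÷ n = x * fromℚ (+ 1 ℚ./ n)

-- ℝ ∪ {∞}; infima are taken here, so that inf ∅ = ∞.
ℝ∞ : Set
ℝ∞ = ℝ ⁺

_≤∞_ : ℝ∞ → ℝ∞ → Set
_≤∞_ = Sup._≤⁺_ _≤_

IsLowerBound : ∀ {ℓ} → Pred ℝ∞ ℓ → ℝ∞ → Set ℓ
IsLowerBound S m = ∀ s → S s → m ≤∞ s

IsInfimum : ∀ {ℓ} → Pred ℝ∞ ℓ → ℝ∞ → Set ℓ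
IsInfimum S m = IsLowerBound S m × (∀ l → IsLowerBound S l → l ≤∞ m)

-- A set of reals as a subset of ℝ ∪ {∞}.
⟦_⟧ : ∀ {ℓ} → Pred ℝ ℓ → Pred ℝ∞ ℓ
⟦ P ⟧ [ x ] = P x
⟦ P ⟧ ⊤⁺    = ⊥

------------------------------------------------------------------------
-- Finite subsets, represented by duplicate-free lists

record FinSubset (A : Set) : Set where
  constructor mkFinSubset
  field
    elems  : List A
    unique : Unique elems

open FinSubset public

module _ {A : Set} where

  infix 4 _⊆_

  card : FinSubset A → ℕ
  card X = length (elems X)

  _⊆_ : FinSubset A → FinSubset A → Set
  X ⊆ Y = elems X ⊆ᴸ elems Y

  private
    all-─ : ∀ {P : Pred A 0ℓ} {xs e} → All P xs → (e∈ : e ∈ xs) → All P (xs ─ e∈)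
    all-─ (_ ∷ pxs)  (here _)   = pxs
    all-─ (px ∷ pxs) (there e∈) = px ∷ all-─ pxs e∈

    unique-─ : ∀ {xs e} → Unique xs → (e∈ : e ∈ xs) → Unique (xs ─ e∈)
    unique-─ (_ ∷ u)  (here _)   = u
    unique-─ (px ∷ u) (there e∈) = all-─ px e∈ ∷ unique-─ u e∈

  -- X ∖ e∈X is X ∖ {e}.
  _∖_ : (X : FinSubset A) {e : A} → e ∈ elems X → FinSubset A
  X ∖ e∈X = mkFinSubset (elems X ─ e∈X) (unique-─ (unique X) e∈X)

  -- |X ∩ R i|, where R i is the fibre of `block` over i.
  card∩ : FinSubset A → (A → ℕ) → ℕ → ℕ
  card∩ X block i = length (filter (λ e → block e ℕ.≟ i) (elems X))

------------------------------------------------------------------------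
-- Countable cardinals: [ n ] is the finite cardinal n, and ⊤⁺ is ℵ₀.

Cardinal : Set
Cardinal = ℕ ⁺

Index : Cardinal → Set
Index [ n ] = Fin n
Index ⊤⁺    = ℕ

_≤ᶜ_ : Cardinal → Cardinal → Set
_≤ᶜ_ = Sup._≤⁺_ ℕ._≤_

position : ∀ {κ k} → [ k ] ≤ᶜ κ → Fin k → Index κ
position [ k≤n ]   i = inject≤ i k≤n
position (_ ≤⊤⁺)   i = toℕ i

position-injective : ∀ {κ k} (k≤κ : [ k ] ≤ᶜ κ) {i j} →
                     position k≤κ i ≡ position k≤κ j → i ≡ j
position-injective [ k≤n ] {i} {j} = inject≤-injective k≤n k≤n i j
position-injective (_ ≤⊤⁺)         = toℕ-injective

------------------------------------------------------------------------
-- Instances of IncMax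

-- O attains Opt(k).
IsOptimum : {A : Set} → (FinSubset A → ℝ) → ℕ → FinSubset A → Set
IsOptimum f k O = card O ≡ k × (∀ X → card X ≡ k → f X ≤ f O)

-- The objective is only evaluated at finite sets. It is well defined on sets
-- (not just on lists) up to _≈_, by monotonicity.
record Instance : Set₁ where
  field
    Element     : Set
    size        : Cardinal
    enumeration : Index size ⤖ Element
    f           : FinSubset Element → ℝ
    nonNegative : ∀ X → 0ℝ ≤ f X
    monotone    : ∀ X Y → X ⊆ Y → f X ≤ f Y
    accountable : ∀ X .{{_ : NonZero (card X)}} →
                  ∃[ e ] Σ[ e∈X ∈ e ∈ elems X ] f X - f X ÷ card X ≤ f (X ∖ e∈X)
    optimum     : ∀ k → [ k ] ≤ᶜ size → ∃[ O ] IsOptimum f k O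

  Opt : ∀ k → [ k ] ≤ᶜ size → ℝ
  Opt k k≤n = f (proj₁ (optimum k k≤n))

  Solution : Set
  Solution = Index size ⤖ Element

  prefix : Solution → ∀ k → [ k ] ≤ᶜ size → FinSubset Element
  prefix σ k k≤n = mkFinSubset
    (tabulate (λ i → Bijection.to σ (position k≤n i)))
    (tabulate⁺ λ eq → position-injective k≤n (Bijection.injective σ eq))

  IsCompetitiveSolution : ℝ → Solution → Set
  IsCompetitiveSolution α σ = ∀ k (k≤n : [ k ] ≤ᶜ size) → Opt k k≤n ≤ α * f (prefix σ k k≤n)

open Instance public using (Solution; IsCompetitiveSolution)

-- The parts of the partition are the fibres of `block`. Empty fibres are
-- allowed, which covers finite partitions; they contribute 0 to the maximum.
record Separable (I : Instance) : Set where
  open Instance I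
  field
    block      : Element → ℕ
    d          : ℕ → ℝ
    d-positive : ∀ i → 0ℝ < d i
    f-upper    : ∀ X i → fromℕ (card∩ X block i) * d i ≤ f X
    f-attained : ∀ X → ∃[ i ] f X ≈ fromℕ (card∩ X block i) * d i

IncMax : Pred Instance 0ℓ
IncMax = U

IncMaxSep : Pred Instance 0ℓ
IncMaxSep = Separable

------------------------------------------------------------------------
-- Competitive ratios

Algorithm : Set₁
Algorithm = (I : Instance) → Solution I

IsCompetitive : Pred Instance 0ℓ → Algorithm → Pred ℝ (lsuc 0ℓ)
IsCompetitive C A α = 1ℝ ≤ α × (∀ I → C I → IsCompetitiveSolution I α (A I))

IsAlgorithmRatio : Pred Instance 0ℓ → Algorithm → Pred ℝ∞ (lsuc 0ℓ)
IsAlgorithmRatio C A = IsInfimum ⟦ IsCompetitive C A ⟧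

IsCompetitiveRatio : Pred Instance 0ℓ → Pred ℝ∞ (lsuc 0ℓ)
IsCompetitiveRatio C = IsInfimum (λ ρ → ∃[ A ] IsAlgorithmRatio C A ρ)

{-# OPTIONS --safe #-}
-- Every separable instance is an instance, so only an algorithm for separable
-- instances has to be turned into one for all instances. Let v m be the largest value
-- of at most 1 + m elements of an instance I and d m = v m / (1 + m). By accountability
-- d is antitone, so the separable instance whose parts have 1 + m elements of value d m,
-- for every m, has the optima of I. Accountability also orders the elements of a set
-- of value v m such that its first j ≤ 1 + m elements are worth at least j (d m).
-- A solution of the separable instance is translated by replacing the j-th element
-- taken from a part by the j-th element in this order. The separable instance has
-- infinitely many singleton parts, all translated to the same element; at every
-- repetition the translated solution takes the first element of I not taken yet,
-- and so it exhausts I.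
-- The infimum over achievable α exists by excluded middle, and it is the competitive
-- ratio of the class.
module Submission where

open import Defs
open import Axiom.ExcludedMiddle using (ExcludedMiddle)
open import Data.Product using (_×_; ∃-syntax; _,_; proj₁; proj₂)
open import Level using (0ℓ; suc; Lift; lift; lower)
open import Data.Fin.Base as Fin using (toℕ; fromℕ<)
open import Data.Fin.Properties using (toℕ-injective; toℕ-inject≤; toℕ<n; toℕ-fromℕ<)
open import Data.Nat.Base as ℕ using (ℕ; zero)
import Data.Nat.Properties as ℕ
import Data.Integer.Base as ℤ
import Data.Integer.Properties as ℤ
open import Data.List.Base using (List; []; _∷_; length; filter; map; tabulate; applyUpTo)
open import Data.List.Membership.DecPropositional ℕ._≟_ using (_∈?_)
open import Data.List.Membership.Propositional using (_∈_; _∉_; find)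
open import Data.List.Membership.Propositional.Properties
open import Data.List.Properties
open import Data.List.Relation.Binary.Subset.Propositional using () renaming (_⊆_ to _⊆ᴸ_)
open import Data.List.Relation.Unary.All as All using (All; []; _∷_)
open import Data.List.Relation.Unary.All.Properties using (¬Any⇒All¬; ¬All⇒Any¬)
open import Data.List.Relation.Unary.AllPairs using ([]; _∷_)
open import Data.List.Relation.Unary.Any using (here; there; index; _─_)
open import Data.List.Relation.Unary.Unique.Propositional using (Unique)
open import Data.List.Relation.Unary.Unique.Propositional.Properties using (tabulate⁺; applyUpTo⁺₁; filter⁺)
open import Data.Rational.Base as ℚ using (ℚ; 0ℚ; 1ℚ; ½)
import Data.Rational.Properties as ℚ
open import Data.Rational.Solver using (module +-*-Solver)
import Data.Rational.Unnormalised.Base as ℚᵘ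
import Data.Rational.Unnormalised.Properties as ℚᵘ
open import Data.Sum.Base using (_⊎_; inj₁; inj₂; [_,_]′)
open import Function.Base using (id; _∘_)
open import Function.Bundles using (_⤖_; mk⤖; module Bijection)
open import Function.Construct.Identity using (⤖-id)
open import Function.Consequences.Propositional using (strictlySurjective⇒surjective)
open import Relation.Binary.Construct.Add.Supremum.NonStrict as Sup using ([_]; _≤⊤⁺)
open import Relation.Binary.Definitions using (tri<; tri≈; tri>)
open import Relation.Binary.PropositionalEquality hiding ([_])
open import Relation.Nullary using (¬_; Dec; yes; no; contradiction; map′; decidable-stable)
open import Relation.Nullary.Construct.Add.Supremum using ([_]; ⊤⁺)
open import Relation.Unary using (Pred)

-- Natural numbers inside ℚ

ι : ℕ → ℚ
ι n = ℤ.+ n ℚ./ 1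

1/1+ : ℕ → ℚ
1/1+ n = ℤ.+ 1 ℚ./ ℕ.suc n

ι-suc : ∀ n → ι (ℕ.suc n) ≡ ι n ℚ.+ 1ℚ
ι-suc n = ℚ.toℚᵘ-injective (begin-equality
  ℚ.toℚᵘ (ι (ℕ.suc n))                   ≃⟨ ℚ.toℚᵘ-fromℚᵘ (ℚᵘ.mkℚᵘ (ℤ.+ ℕ.suc n) 0) ⟩
  ℚᵘ.mkℚᵘ (ℤ.+ ℕ.suc n) 0                ≃⟨ ℚᵘ.*≡* (cong (ℤ._* ℤ.+ 1) (trans (cong ℤ.+_ (ℕ.+-comm 1 n)) (cong (ℤ._+ ℤ.+ 1) (sym (ℤ.*-identityʳ (ℤ.+ n)))))) ⟩
  ℚᵘ.mkℚᵘ (ℤ.+ n) 0 ℚᵘ.+ ℚᵘ.1ℚᵘ          ≃⟨ ℚᵘ.+-congˡ ℚᵘ.1ℚᵘ (ℚ.toℚᵘ-fromℚᵘ (ℚᵘ.mkℚᵘ (ℤ.+ n) 0)) ⟨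
  ℚ.toℚᵘ (ι n) ℚᵘ.+ ℚᵘ.1ℚᵘ               ≃⟨ ℚ.toℚᵘ-homo-+ (ι n) 1ℚ ⟨
  ℚ.toℚᵘ (ι n ℚ.+ 1ℚ)                    ∎)
  where open ℚᵘ.≤-Reasoning

ι*1/1+ : ∀ n → ι (ℕ.suc n) ℚ.* 1/1+ n ≡ 1ℚ
ι*1/1+ n = ℚ.toℚᵘ-injective (begin-equality
  ℚ.toℚᵘ (ι (ℕ.suc n) ℚ.* 1/1+ n)
    ≃⟨ ℚ.toℚᵘ-homo-* (ι (ℕ.suc n)) (1/1+ n) ⟩
  ℚ.toℚᵘ (ι (ℕ.suc n)) ℚᵘ.* ℚ.toℚᵘ (1/1+ n)
    ≃⟨ ℚᵘ.*-cong (ℚ.toℚᵘ-fromℚᵘ (ℚᵘ.mkℚᵘ (ℤ.+ ℕ.suc n) 0)) (ℚ.toℚᵘ-fromℚᵘ (ℚᵘ.mkℚᵘ (ℤ.+ 1) n)) ⟩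
  ℚᵘ.mkℚᵘ (ℤ.+ ℕ.suc n) 0 ℚᵘ.* ℚᵘ.mkℚᵘ (ℤ.+ 1) n
    ≃⟨ ℚᵘ.*-inverseʳ (ℚᵘ.mkℚᵘ (ℤ.+ ℕ.suc n) 0) ⟩
  ℚᵘ.1ℚᵘ ∎)
  where open ℚᵘ.≤-Reasoning

0≤1 : 0ℚ ℚ.≤ 1ℚ
0≤1 = ℚ.nonNegative⁻¹ 1ℚ

p≤p+q : ∀ {p q} → 0ℚ ℚ.≤ q → p ℚ.≤ p ℚ.+ q
p≤p+q {p} {q} 0≤q = subst (ℚ._≤ p ℚ.+ q) (ℚ.+-identityʳ p) (ℚ.+-monoʳ-≤ p 0≤q)

ι-mono : ∀ {m n} → m ℕ.≤ n → ι m ℚ.≤ ι n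
ι-mono {m} m≤n = go (ℕ.≤⇒≤′ m≤n)
  where
  go : ∀ {n} → m ℕ.≤′ n → ι m ℚ.≤ ι n
  go (ℕ.≤′-reflexive refl) = ℚ.≤-refl
  go (ℕ.≤′-step {n} p) = ℚ.≤-trans (go p) (subst (ι n ℚ.≤_) (sym (ι-suc n)) (p≤p+q 0≤1))

0≤ι : ∀ n → 0ℚ ℚ.≤ ι n
0≤ι n = ι-mono {0} {n} ℕ.z≤n

0<1/1+ : ∀ n → 0ℚ ℚ.< 1/1+ n
0<1/1+ n = ℚ.positive⁻¹ _ {{ℚ.normalize-pos 1 (ℕ.suc n)}}

0≤1/1+ : ∀ n → 0ℚ ℚ.≤ 1/1+ n
0≤1/1+ n = ℚ.<⇒≤ (0<1/1+ n)

*-monoˡ-≤ : ∀ {p q r} → 0ℚ ℚ.≤ r → p ℚ.≤ q → r ℚ.* p ℚ.≤ r ℚ.* q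
*-monoˡ-≤ {r = r} 0≤r = ℚ.*-monoˡ-≤-nonNeg r {{ℚ.nonNegative 0≤r}}

*-monoʳ-≤ : ∀ {p q r} → 0ℚ ℚ.≤ r → p ℚ.≤ q → p ℚ.* r ℚ.≤ q ℚ.* r
*-monoʳ-≤ {r = r} 0≤r = ℚ.*-monoʳ-≤-nonNeg r {{ℚ.nonNegative 0≤r}}

*-pos : ∀ {p q} → 0ℚ ℚ.< p → 0ℚ ℚ.< q → 0ℚ ℚ.< p ℚ.* q
*-pos {p} {q} 0<p 0<q =
  subst (ℚ._< p ℚ.* q) (ℚ.*-zeroʳ p) (ℚ.*-monoʳ-<-pos p {{ℚ.positive 0<p}} 0<q)

-- A nonnegative fraction is at most its numerator, because the denominator is at least 1; for
-- negative numbers 0 serves.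
archimedean : ∀ p → ∃[ n ] p ℚ.≤ ι n
archimedean (ℚ.mkℚ (ℤ.+ n) d c) = n , ℚ.toℚᵘ-cancel-≤ (begin
  ℚᵘ.mkℚᵘ (ℤ.+ n) d      ≤⟨ ℚᵘ.*≤* (ℤ.*-monoˡ-≤-nonNeg (ℤ.+ n) (ℤ.+≤+ (ℕ.s≤s ℕ.z≤n))) ⟩
  ℚᵘ.mkℚᵘ (ℤ.+ n) 0      ≃⟨ ℚ.toℚᵘ-fromℚᵘ (ℚᵘ.mkℚᵘ (ℤ.+ n) 0) ⟨
  ℚ.toℚᵘ (ι n)           ∎)
  where open ℚᵘ.≤-Reasoning
archimedean p@(ℚ.mkℚ ℤ.-[1+ n ] d c) = 0 , ℚ.<⇒≤ (ℚ.negative⁻¹ p)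

halve : ∀ {ε} → 0ℚ ℚ.< ε → ∃[ δ ] 0ℚ ℚ.< δ × δ ℚ.+ δ ≡ ε
halve {ε} 0<ε = ε ℚ.* ½ , *-pos 0<ε (ℚ.positive⁻¹ ½) ,
  trans (sym (ℚ.*-distribˡ-+ ε ½ ½)) (ℚ.*-identityʳ ε)

quarter : ∀ {ε} → 0ℚ ℚ.< ε → ∃[ δ ] 0ℚ ℚ.< δ × (δ ℚ.+ δ) ℚ.+ (δ ℚ.+ δ) ≡ ε
quarter {ε} 0<ε with halve 0<ε
... | η , 0<η , refl with halve 0<η
...   | δ , 0<δ , refl = δ , 0<δ , refl

1/1+-small : ∀ {ε} → 0ℚ ℚ.< ε → ∃[ N ] ∀ n → N ℕ.≤ n → 1/1+ n ℚ.≤ ε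
1/1+-small {ε} 0<ε = N , λ n N≤n → begin
  1/1+ n                              ≡⟨ ℚ.*-identityʳ _ ⟨
  1/1+ n ℚ.* 1ℚ                       ≡⟨ cong (1/1+ n ℚ.*_) (ℚ.*-inverseˡ ε) ⟨
  1/1+ n ℚ.* (1/ε ℚ.* ε)              ≤⟨ *-monoˡ-≤ (0≤1/1+ n) (*-monoʳ-≤ (ℚ.<⇒≤ 0<ε) (ℚ.≤-trans 1/ε≤ιN (ι-mono {N} {ℕ.suc n} (ℕ.m≤n⇒m≤1+n N≤n)))) ⟩
  1/1+ n ℚ.* (ι (ℕ.suc n) ℚ.* ε)      ≡⟨ solve 3 (λ a b c → a :* (b :* c) := (b :* a) :* c) refl (1/1+ n) (ι (ℕ.suc n)) ε ⟩
  (ι (ℕ.suc n) ℚ.* 1/1+ n) ℚ.* ε      ≡⟨ cong (ℚ._* ε) (ι*1/1+ n) ⟩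
  1ℚ ℚ.* ε                            ≡⟨ ℚ.*-identityˡ ε ⟩
  ε                                   ∎
  where
  open ℚ.≤-Reasoning
  open +-*-Solver
  instance
    ε≢0 : ℚ.NonZero ε
    ε≢0 = ℚ.pos⇒nonZero ε {{ℚ.positive 0<ε}}
  1/ε = ℚ.1/ ε
  N = proj₁ (archimedean 1/ε)
  1/ε≤ιN = proj₂ (archimedean 1/ε)

-- Real numbers

Eventually : Pred ℕ 0ℓ → Set
Eventually P = ∃[ N ] ∀ n → N ℕ.≤ n → P n

module _ {P Q : Pred ℕ 0ℓ} where

  eventually-map : (∀ {n} → P n → Q n) → Eventually P → Eventually Q
  eventually-map h (N , p) = N , λ n N≤n → h (p n N≤n)

  eventually-map₂ : ∀ {R : Pred ℕ 0ℓ} → (∀ {n} → P n → Q n → R n) →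
                    Eventually P → Eventually Q → Eventually R
  eventually-map₂ h (M , p) (N , q) = M ℕ.⊔ N , λ n M⊔N≤n →
    h (p n (ℕ.m⊔n≤o⇒m≤o M N M⊔N≤n)) (q n (ℕ.m⊔n≤o⇒n≤o M N M⊔N≤n))

≤-eventually : ∀ x y → Eventually (λ n → seq x n ℚ.≤ seq y n) → x ≤ y
≤-eventually x y x≤y ε 0<ε =
  eventually-map (λ p → ℚ.≤-trans p (p≤p+q (ℚ.<⇒≤ 0<ε))) x≤y

≤-pointwise : ∀ x y → (∀ n → seq x n ℚ.≤ seq y n) → x ≤ y
≤-pointwise x y x≤y = ≤-eventually x y (0 , λ n _ → x≤y n)

≡-pointwise : ∀ x y → (∀ n → seq x n ≡ seq y n) → x ≤ y
≡-pointwise x y x≡y = ≤-pointwise x y (λ n → ℚ.≤-reflexive (x≡y n))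

≤-refl : ∀ {x} → x ≤ x
≤-refl {x} = ≤-pointwise x x (λ _ → ℚ.≤-refl)

≤-trans : ∀ {x y z} → x ≤ y → y ≤ z → x ≤ z
≤-trans {x} {y} {z} x≤y y≤z ε 0<ε with halve 0<ε
... | δ , 0<δ , refl = eventually-map₂
  (λ {n} p q → ℚ.≤-trans p (ℚ.≤-trans (ℚ.+-monoˡ-≤ δ q) (ℚ.≤-reflexive (ℚ.+-assoc (seq z n) δ δ))))
  (x≤y δ 0<δ) (y≤z δ 0<δ)

p≤∣p∣ : ∀ p → p ℚ.≤ ℚ.∣ p ∣
p≤∣p∣ p with ℚ.≤-total 0ℚ p
... | inj₁ 0≤p = ℚ.≤-reflexive (sym (ℚ.0≤p⇒∣p∣≡p 0≤p))
... | inj₂ p≤0 = ℚ.≤-trans p≤0 (ℚ.0≤∣p∣ p)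

∣p-q∣<r⇒p≤q+r : ∀ {p q r} → ℚ.∣ p ℚ.- q ∣ ℚ.< r → p ℚ.≤ q ℚ.+ r
∣p-q∣<r⇒p≤q+r {p} {q} {r} h = begin
  p                       ≡⟨ solve 2 (λ p q → p := q :+ (p :- q)) refl p q ⟩
  q ℚ.+ (p ℚ.- q)         ≤⟨ ℚ.+-monoʳ-≤ q (p≤∣p∣ (p ℚ.- q)) ⟩
  q ℚ.+ ℚ.∣ p ℚ.- q ∣     ≤⟨ ℚ.+-monoʳ-≤ q (ℚ.<⇒≤ h) ⟩
  q ℚ.+ r                 ∎
  where
  open ℚ.≤-Reasoning
  open +-*-Solver

cauchy-≤ : ∀ x {ε} → 0ℚ ℚ.< ε →
           ∃[ N ] ∀ m n → N ℕ.≤ m → N ℕ.≤ n → seq x m ℚ.≤ seq x n ℚ.+ ε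
cauchy-≤ x {ε} 0<ε with N , h ← cauchy x ε 0<ε =
  N , λ m n N≤m N≤n → ∣p-q∣<r⇒p≤q+r {seq x m} {seq x n} (h m n N≤m N≤n)

-- Moves terms across an inequality. The equality of the two differences is a ring identity, left to
-- the solver at each use.
rearrange : ∀ {p q r s} → p ℚ.≤ q → q ℚ.- p ≡ s ℚ.- r → r ℚ.≤ s
rearrange {p} {q} {r} {s} p≤q eq = begin
  r                     ≡⟨ solve 2 (λ r p → r := r :+ (p :- p)) refl r p ⟩
  r ℚ.+ (p ℚ.- p)       ≤⟨ ℚ.+-monoʳ-≤ r (ℚ.+-monoˡ-≤ (ℚ.- p) p≤q) ⟩
  r ℚ.+ (q ℚ.- p)       ≡⟨ cong (r ℚ.+_) eq ⟩
  r ℚ.+ (s ℚ.- r)       ≡⟨ solve 2 (λ r s → r :+ (s :- r) := s) refl r s ⟩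
  s                     ∎
  where
  open ℚ.≤-Reasoning
  open +-*-Solver

difference-≤ : ∀ {x y z η} → y ℚ.- x ℚ.≤ z ℚ.+ η → z ℚ.≤ η → y ℚ.≤ x ℚ.+ (η ℚ.+ η)
difference-≤ {x} {y} {z} {η} p z≤η =
  rearrange {y ℚ.- x} {η ℚ.+ η} {y} {x ℚ.+ (η ℚ.+ η)} (ℚ.≤-trans p (ℚ.+-monoˡ-≤ η z≤η))
    (solve 3 (λ x y η → (η :+ η) :- (y :- x) := (x :+ (η :+ η)) :- y) refl x y η)
  where open +-*-Solver

difference-≥ : ∀ {x y z η} → ¬ z ℚ.≤ η → z ℚ.≤ (y ℚ.- x) ℚ.+ η → x ℚ.≤ y
difference-≥ {x} {y} {z} {η} z≰η p =
  rearrange {η} {(y ℚ.- x) ℚ.+ η} {x} {y} (ℚ.≤-trans (ℚ.<⇒≤ (ℚ.≰⇒> z≰η)) p)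
    (solve 3 (λ x y η → ((y :- x) :+ η) :- η := y :- x) refl x y η)
  where open +-*-Solver

-- One rational comparison decides. From some index N on, y - x varies by at most η = ε/2. If its
-- value at N is at most η, later values are at most ε; otherwise later values are nonnegative,
-- which gives the excluded x ≤ y.
≰⇒≥ : ∀ {x y} → ¬ x ≤ y → y ≤ x
≰⇒≥ {x} {y} x≰y ε 0<ε = main (halve 0<ε)
  where
  main : ∃[ η ] 0ℚ ℚ.< η × η ℚ.+ η ≡ ε → Eventually (λ n → seq y n ℚ.≤ seq x n ℚ.+ ε)
  main (η , 0<η , refl) = split (cauchy-≤ (y - x) 0<η)
    where
    split : ∃[ N ] (∀ m n → N ℕ.≤ m → N ℕ.≤ n →
              seq y m ℚ.- seq x m ℚ.≤ (seq y n ℚ.- seq x n) ℚ.+ η) →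
            Eventually (λ n → seq y n ℚ.≤ seq x n ℚ.+ (η ℚ.+ η))
    split (N , h) with (seq y N ℚ.- seq x N) ℚ.≤? η
    ... | yes z≤η = N , λ n N≤n →
          difference-≤ {seq x n} {seq y n} (h n N N≤n ℕ.≤-refl) z≤η
    ... | no  z≰η = contradiction
          (≤-eventually x y (N , λ n N≤n → difference-≥ {seq x n} {seq y n} z≰η (h N n ℕ.≤-refl N≤n)))
          x≰y

gap-≤ : ∀ {x z γ} → 0ℚ ℚ.< γ → x ℚ.≤ z ℚ.+ γ → z ℚ.≤ γ ℚ.+ γ → x ℚ.≤ 0ℚ ℚ.+ ((γ ℚ.+ γ) ℚ.+ (γ ℚ.+ γ))
gap-≤ {x} {z} {γ} 0<γ p z≤2γ = begin
  x                                   ≤⟨ p ⟩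
  z ℚ.+ γ                             ≤⟨ ℚ.+-mono-≤ z≤2γ (p≤p+q {γ} {γ} (ℚ.<⇒≤ 0<γ)) ⟩
  (γ ℚ.+ γ) ℚ.+ (γ ℚ.+ γ)             ≡⟨ ℚ.+-identityˡ _ ⟨
  0ℚ ℚ.+ ((γ ℚ.+ γ) ℚ.+ (γ ℚ.+ γ))    ∎
  where open ℚ.≤-Reasoning

gap-≥ : ∀ {x z γ} → ¬ z ℚ.≤ γ ℚ.+ γ → z ℚ.≤ x ℚ.+ γ → 0ℚ ℚ.+ γ ℚ.≤ x
gap-≥ {x} {z} {γ} z≰2γ p =
  rearrange {γ ℚ.+ γ} {x ℚ.+ γ} {0ℚ ℚ.+ γ} {x} (ℚ.≤-trans (ℚ.<⇒≤ (ℚ.≰⇒> z≰2γ)) p)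
    (solve 2 (λ x γ → (x :+ γ) :- (γ :+ γ) := x :- (con 0ℚ :+ γ)) refl x γ)
  where open +-*-Solver

-- As for `≰⇒≥`, but `_<_` demands a fixed positive gap. With ε = 4γ the threshold is 2γ: a term
-- above it keeps all later terms above γ, and a term below it keeps them below 3γ.
≮⇒≥ : ∀ {x} → ¬ 0ℝ < x → x ≤ 0ℝ
≮⇒≥ {x} 0≮x ε 0<ε = main (quarter 0<ε)
  where
  main : ∃[ γ ] 0ℚ ℚ.< γ × (γ ℚ.+ γ) ℚ.+ (γ ℚ.+ γ) ≡ ε → Eventually (λ n → seq x n ℚ.≤ 0ℚ ℚ.+ ε)
  main (γ , 0<γ , refl) = split (cauchy-≤ x 0<γ)
    where
    split : ∃[ N ] (∀ m n → N ℕ.≤ m → N ℕ.≤ n → seq x m ℚ.≤ seq x n ℚ.+ γ) →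
            Eventually (λ n → seq x n ℚ.≤ 0ℚ ℚ.+ ((γ ℚ.+ γ) ℚ.+ (γ ℚ.+ γ)))
    split (N , h) with seq x N ℚ.≤? (γ ℚ.+ γ)
    ... | yes xN≤2γ = N , λ n N≤n → gap-≤ {seq x n} {seq x N} {γ} 0<γ (h n N N≤n ℕ.≤-refl) xN≤2γ
    ... | no  xN≰2γ = contradiction
          (γ , 0<γ , N , λ n N≤n → gap-≥ {seq x n} {seq x N} {γ} xN≰2γ (h N n ℕ.≤-refl N≤n))
          0≮x

<-≤-trans : ∀ {x y z} → x < y → y ≤ z → x < z
<-≤-trans {x} {y} {z} (ε , 0<ε , x<y) y≤z with halve 0<ε
... | δ , 0<δ , refl = δ , 0<δ , eventually-map₂
  (λ {n} p q → rearrange {seq x n ℚ.+ (δ ℚ.+ δ)} {seq z n ℚ.+ δ} {seq x n ℚ.+ δ} {seq z n} (ℚ.≤-trans p q)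
    (solve 3 (λ x z δ → (z :+ δ) :- (x :+ (δ :+ δ)) := z :- (x :+ δ)) refl (seq x n) (seq z n) δ))
  x<y (y≤z δ 0<δ)
  where open +-*-Solver

eventually-≤ι : ∀ x → ∃[ N ] Eventually (λ n → seq x n ℚ.≤ ι N)
eventually-≤ι x =
  let M , h      = cauchy-≤ x (ℚ.positive⁻¹ 1ℚ)
      N , xM+1≤N = archimedean (seq x M ℚ.+ 1ℚ)
  in N , M , λ n M≤n → ℚ.≤-trans (h n M M≤n ℕ.≤-refl) xM+1≤N

-- Nonnegativity is asked of the terms of a tail, since `0ℝ ≤ z` bounds the terms only up to an
-- error and the estimate here is termwise.
*-monoʳ-≤ℝ : ∀ z {x y} → Eventually (λ n → 0ℚ ℚ.≤ seq z n) → x ≤ y → z * x ≤ z * y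
*-monoʳ-≤ℝ z {x} {y} 0≤z x≤y ε 0<ε =
  eventually-map₂ (λ {n} → bound n) 0≤z
    (eventually-map₂ _,_ z≤N (x≤y δ (*-pos (0<1/1+ N) 0<ε)))
  where
  open ℚ.≤-Reasoning
  open +-*-Solver
  N   = proj₁ (eventually-≤ι z)
  z≤N = proj₂ (eventually-≤ι z)
  -- The terms of z are eventually at most N, so the error z δ is at most (1 + N) δ = ε.
  δ   = 1/1+ N ℚ.* ε
  bound : ∀ n → 0ℚ ℚ.≤ seq z n →
          (seq z n ℚ.≤ ι N) × (seq x n ℚ.≤ seq y n ℚ.+ δ) →
          seq z n ℚ.* seq x n ℚ.≤ seq z n ℚ.* seq y n ℚ.+ ε
  bound n 0≤zₙ (zₙ≤N , xₙ≤yₙ+δ) = begin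
    seq z n ℚ.* seq x n                            ≤⟨ *-monoˡ-≤ 0≤zₙ xₙ≤yₙ+δ ⟩
    seq z n ℚ.* (seq y n ℚ.+ δ)                    ≡⟨ ℚ.*-distribˡ-+ (seq z n) (seq y n) δ ⟩
    seq z n ℚ.* seq y n ℚ.+ seq z n ℚ.* δ          ≤⟨ ℚ.+-monoʳ-≤ (seq z n ℚ.* seq y n) (*-monoʳ-≤ (ℚ.<⇒≤ (*-pos (0<1/1+ N) 0<ε)) (ℚ.≤-trans zₙ≤N (ι-mono {N} {ℕ.suc N} (ℕ.n≤1+n N)))) ⟩
    seq z n ℚ.* seq y n ℚ.+ ι (ℕ.suc N) ℚ.* δ      ≡⟨ cong (seq z n ℚ.* seq y n ℚ.+_) (trans (sym (ℚ.*-assoc (ι (ℕ.suc N)) (1/1+ N) ε)) (trans (cong (ℚ._* ε) (ι*1/1+ N)) (ℚ.*-identityˡ ε))) ⟩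
    seq z n ℚ.* seq y n ℚ.+ ε                      ∎

fromℚ-*-mono : ∀ {q} x y → 0ℚ ℚ.≤ q → x ≤ y → fromℚ q * x ≤ fromℚ q * y
fromℚ-*-mono {q} x y 0≤q = *-monoʳ-≤ℝ (fromℚ q) {x} {y} (0 , λ _ _ → 0≤q)

0<⇒eventually : ∀ {x} → 0ℝ < x → Eventually (λ n → 0ℚ ℚ.≤ seq x n)
0<⇒eventually {x} (ε , 0<ε , h) = eventually-map
  (λ {n} p → ℚ.≤-trans (ℚ.<⇒≤ 0<ε) (subst (ℚ._≤ seq x n) (ℚ.+-identityˡ ε) p)) h

1≤⇒eventually : ∀ {x} → 1ℝ ≤ x → Eventually (λ n → 0ℚ ℚ.≤ seq x n)
1≤⇒eventually {x} 1≤x = eventually-map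
  (λ {n} p → rearrange {1ℚ} {seq x n ℚ.+ 1ℚ} {0ℚ} {seq x n} p (solve 1 (λ x → (x :+ con 1ℚ) :- con 1ℚ := x :- con 0ℚ) refl (seq x n)))
  (1≤x 1ℚ (ℚ.positive⁻¹ 1ℚ))
  where open +-*-Solver

0≤* : ∀ z {x} → Eventually (λ n → 0ℚ ℚ.≤ seq z n) → 0ℝ ≤ x → 0ℝ ≤ z * x
0≤* z {x} 0≤z 0≤x = ≤-trans {0ℝ} {z * 0ℝ} {z * x}
  (≡-pointwise 0ℝ (z * 0ℝ) (λ n → sym (ℚ.*-zeroʳ (seq z n))))
  (*-monoʳ-≤ℝ z {0ℝ} {x} 0≤z 0≤x)

fromℕ-*-monoˡ : ∀ {m n d} → 0ℝ < d → m ℕ.≤ n → fromℕ m * d ≤ fromℕ n * d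
fromℕ-*-monoˡ {m} {n} {d} 0<d m≤n = ≤-eventually (fromℕ m * d) (fromℕ n * d)
  (eventually-map (λ 0≤d → *-monoʳ-≤ 0≤d (ι-mono {m} {n} m≤n)) (0<⇒eventually {d} 0<d))

0≤fromℕ* : ∀ n {d} → 0ℝ < d → 0ℝ ≤ fromℕ n * d
0≤fromℕ* n {d} 0<d = ≤-eventually 0ℝ (fromℕ n * d)
  (eventually-map (λ {k} 0≤d → subst (ℚ._≤ ι n ℚ.* seq d k) (ℚ.*-zeroʳ (ι n)) (*-monoˡ-≤ (0≤ι n) 0≤d))
    (0<⇒eventually {d} 0<d))

-- Division by positive integers

suc*÷ : ∀ n p → ι (ℕ.suc n) ℚ.* (p ℚ.* 1/1+ n) ≡ p
suc*÷ n p = begin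
  ι (ℕ.suc n) ℚ.* (p ℚ.* 1/1+ n)    ≡⟨ solve 3 (λ a p b → a :* (p :* b) := (a :* b) :* p) refl (ι (ℕ.suc n)) p (1/1+ n) ⟩
  (ι (ℕ.suc n) ℚ.* 1/1+ n) ℚ.* p    ≡⟨ cong (ℚ._* p) (ι*1/1+ n) ⟩
  1ℚ ℚ.* p                          ≡⟨ ℚ.*-identityˡ p ⟩
  p                                 ∎
  where
  open ≡-Reasoning
  open +-*-Solver

suc*÷-≤ : ∀ n x → fromℕ (ℕ.suc n) * (x ÷ ℕ.suc n) ≤ x
suc*÷-≤ n x = ≡-pointwise (fromℕ (ℕ.suc n) * (x ÷ ℕ.suc n)) x (λ k → suc*÷ n (seq x k))

suc*÷-≥ : ∀ n x → x ≤ fromℕ (ℕ.suc n) * (x ÷ ℕ.suc n)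
suc*÷-≥ n x = ≡-pointwise x (fromℕ (ℕ.suc n) * (x ÷ ℕ.suc n)) (λ k → sym (suc*÷ n (seq x k)))

0<÷ : ∀ n {x} → 0ℝ < x → 0ℝ < x ÷ ℕ.suc n
0<÷ n {x} (ε , 0<ε , h) = ε ℚ.* 1/1+ n , *-pos 0<ε (0<1/1+ n) , eventually-map
  (λ {k} ε≤x → subst (ℚ._≤ seq x k ℚ.* 1/1+ n) (sym (ℚ.+-identityˡ _))
    (*-monoʳ-≤ (0≤1/1+ n) (subst (ℚ._≤ seq x k) (ℚ.+-identityˡ ε) ε≤x))) h

fromℕ-*-cancelˡ : ∀ n {x y} → fromℕ (ℕ.suc n) * x ≤ fromℕ (ℕ.suc n) * y → x ≤ y
fromℕ-*-cancelˡ n {x} {y} h =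
  ≤-trans {x} {w * (s * x)} {y} (≡-pointwise x (w * (s * x)) (λ k → sym (cancel (seq x k))))
    (≤-trans {w * (s * x)} {w * (s * y)} {y} (fromℚ-*-mono (s * x) (s * y) (0≤1/1+ n) h)
      (≡-pointwise (w * (s * y)) y (λ k → cancel (seq y k))))
  where
  w = fromℚ (1/1+ n)
  s = fromℕ (ℕ.suc n)
  open +-*-Solver
  cancel : ∀ p → 1/1+ n ℚ.* (ι (ℕ.suc n) ℚ.* p) ≡ p
  cancel p = trans
    (solve 3 (λ a b p → a :* (b :* p) := b :* (p :* a)) refl (1/1+ n) (ι (ℕ.suc n)) p)
    (suc*÷ n p)

remove-one : ∀ n p → p ℚ.- p ℚ.* 1/1+ n ≡ (ι n ℚ.* 1/1+ n) ℚ.* p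
remove-one n p = begin
  p ℚ.- p ℚ.* 1/1+ n
    ≡⟨ cong (ℚ._- p ℚ.* 1/1+ n) (suc*÷ n p) ⟨
  ι (ℕ.suc n) ℚ.* (p ℚ.* 1/1+ n) ℚ.- p ℚ.* 1/1+ n
    ≡⟨ cong (λ s → s ℚ.* (p ℚ.* 1/1+ n) ℚ.- p ℚ.* 1/1+ n) (ι-suc n) ⟩
  (ι n ℚ.+ 1ℚ) ℚ.* (p ℚ.* 1/1+ n) ℚ.- p ℚ.* 1/1+ n
    ≡⟨ solve 3 (λ m p w → (m :+ con 1ℚ) :* (p :* w) :- p :* w := (m :* w) :* p) refl (ι n) p (1/1+ n) ⟩
  (ι n ℚ.* 1/1+ n) ℚ.* p ∎
  where
  open ≡-Reasoning
  open +-*-Solver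

-- Multiplying the hypothesis by n / (1 + n) turns its sides into n d and x - x / (1 + n). This is
-- how one accountable removal preserves a density.
density-≤ : ∀ n {d x} → fromℕ (ℕ.suc n) * d ≤ x → fromℕ n * d ≤ x - x ÷ ℕ.suc n
density-≤ n {d} {x} h =
  ≤-trans {fromℕ n * d} {c * s} {x - x ÷ ℕ.suc n}
    (≡-pointwise (fromℕ n * d) (c * s) (λ k → sym (eq (seq d k))))
    (≤-trans {c * s} {c * x} {x - x ÷ ℕ.suc n}
      (fromℚ-*-mono s x (subst (ℚ._≤ ι n ℚ.* 1/1+ n) (ℚ.*-zeroʳ (ι n)) (*-monoˡ-≤ (0≤ι n) (0≤1/1+ n))) h)
      (≡-pointwise (c * x) (x - x ÷ ℕ.suc n) (λ k → sym (remove-one n (seq x k)))))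
  where
  open +-*-Solver
  c = fromℚ (ι n ℚ.* 1/1+ n)
  s = fromℕ (ℕ.suc n) * d
  eq : ∀ p → (ι n ℚ.* 1/1+ n) ℚ.* (ι (ℕ.suc n) ℚ.* p) ≡ ι n ℚ.* p
  eq p = trans
    (solve 4 (λ m w s p → (m :* w) :* (s :* p) := s :* ((m :* p) :* w)) refl (ι n) (1/1+ n) (ι (ℕ.suc n)) p)
    (suc*÷ n (ι n ℚ.* p))

density-≡ : ∀ n d → let x = fromℕ (ℕ.suc n) * d in x - x ÷ ℕ.suc n ≤ fromℕ n * d
density-≡ n d = ≡-pointwise (x - x ÷ ℕ.suc n) (fromℕ n * d) (λ k → trans (remove-one n (seq x k))
  (trans (solve 4 (λ m w s p → (m :* w) :* (s :* p) := s :* ((m :* p) :* w)) refl (ι n) (1/1+ n) (ι (ℕ.suc n)) (seq d k))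
    (suc*÷ n (ι n ℚ.* seq d k))))
  where
  open +-*-Solver
  x = fromℕ (ℕ.suc n) * d

x-x÷n≤x : ∀ n {x} → 0ℝ ≤ x → x - x ÷ ℕ.suc n ≤ x
x-x÷n≤x n {x} 0≤x ε 0<ε = eventually-map
  (λ {k} p → rearrange {0ℚ} {1/1+ n ℚ.* seq x k ℚ.+ ε} {seq x k ℚ.- seq x k ℚ.* 1/1+ n} {seq x k ℚ.+ ε} p (solve 3 (λ w x ε → (w :* x :+ ε) :- con 0ℚ := (x :+ ε) :- (x :- x :* w)) refl (1/1+ n) (seq x k) ε))
  (0≤* (fromℚ (1/1+ n)) {x} (0 , λ _ _ → 0≤1/1+ n) 0≤x ε 0<ε)
  where open +-*-Solver

fromℚ-mono : ∀ {p q} → p ℚ.≤ q → fromℚ p ≤ fromℚ q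
fromℚ-mono {p} {q} p≤q = ≤-pointwise (fromℚ p) (fromℚ q) (λ _ → p≤q)

¬fromℕ-unbounded : ∀ {x} → ¬ (∀ N → fromℚ (ι N) ≤ x)
¬fromℕ-unbounded {x} h =
  let N , M , x≤N   = eventually-≤ι x
      -- The offset 2 absorbs the slack 1: since x is eventually at most N, it yields 2 + N ≤ N + 1.
      M′ , 2+N≤x+1  = h (ℕ.suc (ℕ.suc N)) 1ℚ (ℚ.positive⁻¹ 1ℚ)
      k             = M ℕ.⊔ M′
  in ℚ.<-irrefl {1ℚ} {1ℚ} refl (ℚ.<-≤-trans 1<2 (two≤one N (ℚ.≤-trans
       (2+N≤x+1 k (ℕ.m≤n⊔m M M′)) (ℚ.+-monoˡ-≤ 1ℚ (x≤N k (ℕ.m≤m⊔n M M′))))))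
  where
  open +-*-Solver
  1<2 : 1ℚ ℚ.< 1ℚ ℚ.+ 1ℚ
  1<2 = subst (ℚ._< 1ℚ ℚ.+ 1ℚ) (ℚ.+-identityʳ 1ℚ) (ℚ.+-monoʳ-< 1ℚ (ℚ.positive⁻¹ 1ℚ))
  two≤one : ∀ N → ι (ℕ.suc (ℕ.suc N)) ℚ.≤ ι N ℚ.+ 1ℚ → 1ℚ ℚ.+ 1ℚ ℚ.≤ 1ℚ
  two≤one N p = rearrange {(ι N ℚ.+ 1ℚ) ℚ.+ 1ℚ} {ι N ℚ.+ 1ℚ} {1ℚ ℚ.+ 1ℚ} {1ℚ}
    (subst (ℚ._≤ ι N ℚ.+ 1ℚ) (trans (ι-suc (ℕ.suc N)) (cong (ℚ._+ 1ℚ) (ι-suc N))) p)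
    (solve 1 (λ a → (a :+ con 1ℚ) :- ((a :+ con 1ℚ) :+ con 1ℚ) := con 1ℚ :- (con 1ℚ :+ con 1ℚ)) refl (ι N))

∣p-q∣≤ : ∀ {p q r} → p ℚ.≤ q ℚ.+ r → q ℚ.≤ p ℚ.+ r → ℚ.∣ p ℚ.- q ∣ ℚ.≤ r
∣p-q∣≤ {p} {q} {r} h k with ℚ.∣p∣≡p∨∣p∣≡-p (p ℚ.- q)
... | inj₁ eq = subst (ℚ._≤ r) (sym eq) (rearrange {p} {q ℚ.+ r} {p ℚ.- q} {r} h
                  (solve 3 (λ p q r → (q :+ r) :- p := r :- (p :- q)) refl p q r))
  where open +-*-Solver
... | inj₂ eq = subst (ℚ._≤ r) (sym eq) (rearrange {q} {p ℚ.+ r} {ℚ.- (p ℚ.- q)} {r} k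
                  (solve 3 (λ p q r → (p :+ r) :- q := r :- (:- (p :- q))) refl p q r))
  where open +-*-Solver

-- Order and maxima of reals under excluded middle.

module _ (em : ExcludedMiddle (suc 0ℓ)) where

  dec : (P : Set) → Dec P
  dec P = map′ lower lift (em {Lift (suc 0ℓ) P})

  ≤-total : ∀ x y → x ≤ y ⊎ y ≤ x
  ≤-total x y with dec (x ≤ y)
  ... | yes x≤y = inj₁ x≤y
  ... | no  x≰y = inj₂ (≰⇒≥ {x} {y} x≰y)

  abstract
    maximum-over : (g : ℕ → ℝ) (is : List ℕ) → ∃[ i ] ∀ j → j ∈ is → g j ≤ g i
    -- The index returned for the empty list is arbitrary.
    maximum-over g [] = 0 , λ _ ()
    maximum-over g (i ∷ is) with maximum-over g is
    ... | k , h with ≤-total (g i) (g k)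
    ...   | inj₁ i≤k = k , λ { _ (here refl) → i≤k ; j (there j∈) → h j j∈ }
    ...   | inj₂ k≤i = i , λ { _ (here refl) → ≤-refl {g i}
                             ; j (there j∈) → ≤-trans {g j} {g k} {g i} (h j j∈) k≤i }

  -- If x is positive, its terms are eventually nonnegative and 1 ≤ α can be multiplied by it;
  -- otherwise x ≤ 0 ≤ α x.
  1≤α⇒x≤α*x : ∀ {α x} → 1ℝ ≤ α → 0ℝ ≤ x → x ≤ α * x
  1≤α⇒x≤α*x {α} {x} 1≤α 0≤x with dec (0ℝ < x)
  ... | yes 0<x = ≤-trans {x} {x * 1ℝ} {α * x}
          (≡-pointwise x (x * 1ℝ) (λ n → sym (ℚ.*-identityʳ (seq x n))))
          (≤-trans {x * 1ℝ} {x * α} {α * x}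
            (*-monoʳ-≤ℝ x {1ℝ} {α} (0<⇒eventually {x} 0<x) 1≤α)
            (≡-pointwise (x * α) (α * x) (λ n → ℚ.*-comm (seq x n) (seq α n))))
  ... | no  0≮x = ≤-trans {x} {0ℝ} {α * x} (≮⇒≥ {x} 0≮x) (0≤* α {x} (1≤⇒eventually {α} 1≤α) 0≤x)

  -- Infima of sets of nonnegative reals.

  module Infimum (P : Pred ℝ (suc 0ℓ)) (0≤P : ∀ x → P x → 0ℝ ≤ x)
                 {x₀ : ℝ} (Px₀ : P x₀) where

    Below : ℚ → Set (suc 0ℓ)
    Below q = ∀ x → P x → fromℚ q ≤ x

    below-down : ∀ {p q} → p ℚ.≤ q → Below q → Below p
    below-down {p} {q} p≤q h x Px =
      ≤-trans {fromℚ p} {fromℚ q} {x} (fromℚ-mono p≤q) (h x Px)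

    -- Otherwise every multiple of 1/(n+1) would be a lower bound.
    approximation : ∀ n → ∃[ q ] Below q × ¬ Below (q ℚ.+ 1/1+ n)
    approximation n with em {∃[ q ] Below q × ¬ Below (q ℚ.+ 1/1+ n)}
    ... | yes h = h
    ... | no ¬h = contradiction (λ N → all-ℕ N x₀ Px₀) (¬fromℕ-unbounded {x₀})
      where
      step : ∀ q → Below q → Below (q ℚ.+ 1/1+ n)
      step q b with em {Below (q ℚ.+ 1/1+ n)}
      ... | yes b′ = b′
      ... | no ¬b′ = contradiction (q , b , ¬b′) ¬h

      multiples : ∀ k → Below (ι k ℚ.* 1/1+ n)
      multiples zero = subst Below (sym (ℚ.*-zeroˡ (1/1+ n))) 0≤P
      multiples (ℕ.suc k) = subst Below eq (step _ (multiples k))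
        where
        open +-*-Solver
        eq : ι k ℚ.* 1/1+ n ℚ.+ 1/1+ n ≡ ι (ℕ.suc k) ℚ.* 1/1+ n
        eq = trans
          (solve 2 (λ k w → k :* w :+ w := (k :+ con 1ℚ) :* w) refl (ι k) (1/1+ n))
          (cong (ℚ._* 1/1+ n) (sym (ι-suc k)))

      all-ℕ : ∀ N → Below (ι N)
      all-ℕ N = below-down (ℚ.≤-trans (ℚ.≤-reflexive eq) (*-monoʳ-≤ (0≤1/1+ n) le)) (multiples k)
        where
        open +-*-Solver
        -- `k` is at least (1 + n) N, so the lower bound k / (1 + n) is at least N.
        k  = proj₁ (archimedean (ι (ℕ.suc n) ℚ.* ι N))
        le = proj₂ (archimedean (ι (ℕ.suc n) ℚ.* ι N))
        eq : ι N ≡ (ι (ℕ.suc n) ℚ.* ι N) ℚ.* 1/1+ n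
        eq = trans (sym (suc*÷ n (ι N)))
          (solve 3 (λ s a w → s :* (a :* w) := (s :* a) :* w) refl (ι (ℕ.suc n)) (ι N) (1/1+ n))

    q : ℕ → ℚ
    q n = proj₁ (approximation n)

    q-below : ∀ n → Below (q n)
    q-below n = proj₁ (proj₂ (approximation n))

    q-tight : ∀ n → ¬ Below (q n ℚ.+ 1/1+ n)
    q-tight n = proj₂ (proj₂ (approximation n))

    -- A lower bound above q n + 1/(1 + n) would make the latter a lower bound too, against
    -- `q-tight`. Applied to p = q m, this makes the sequence q Cauchy.
    below⇒≤ : ∀ {p} → Below p → ∀ n → p ℚ.≤ q n ℚ.+ 1/1+ n
    below⇒≤ {p} b n with ℚ.≤-total p (q n ℚ.+ 1/1+ n)
    ... | inj₁ le = le
    ... | inj₂ ge = contradiction (below-down ge b) (q-tight n)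

    below⇒eventually-≤ : ∀ {p ε} → Below p → 0ℚ ℚ.< ε → Eventually (λ n → p ℚ.≤ q n ℚ.+ ε)
    below⇒eventually-≤ b 0<ε = eventually-map
      (λ {n} small → ℚ.≤-trans (below⇒≤ b n) (ℚ.+-monoʳ-≤ (q n) small)) (1/1+-small 0<ε)

    q-cauchy : ∀ {ε} → 0ℚ ℚ.< ε → ∃[ N ] ∀ m n → N ℕ.≤ m → N ℕ.≤ n → q m ℚ.≤ q n ℚ.+ ε
    q-cauchy 0<ε = let N , small = 1/1+-small 0<ε in
      N , λ m n N≤m N≤n → ℚ.≤-trans (below⇒≤ (q-below m) n) (ℚ.+-monoʳ-≤ (q n) (small n N≤n))

    infimum : ℝ
    infimum = mkℝ q λ ε 0<ε →
      -- Both differences are at most δ, half of ε, because `cauchy` asks for a strict inequality.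
      let δ , 0<δ , δ+δ≡ε = halve 0<ε
          N , h           = q-cauchy 0<δ
      in N , λ m n N≤m N≤n → ℚ.≤-<-trans (∣p-q∣≤ (h m n N≤m N≤n) (h n m N≤n N≤m))
           (subst₂ ℚ._<_ (ℚ.+-identityʳ δ) δ+δ≡ε (ℚ.+-monoʳ-< δ 0<δ))

    infimum-lower : ∀ x → P x → infimum ≤ x
    infimum-lower x Px ε 0<ε =
      let δ , 0<δ , δ+δ≡ε = halve 0<ε
          N , h           = q-cauchy 0<δ
      in eventually-map₂
           (λ {n} qₙ≤q+δ q≤x+δ → subst (λ ε → q n ℚ.≤ seq x n ℚ.+ ε) δ+δ≡ε
             (ℚ.≤-trans qₙ≤q+δ (ℚ.≤-trans (ℚ.+-monoˡ-≤ δ q≤x+δ)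
               (ℚ.≤-reflexive (ℚ.+-assoc (seq x n) δ δ)))))
           (N , λ n N≤n → h n N N≤n ℕ.≤-refl) (q-below N x Px δ 0<δ)

    -- Otherwise, by totality, q n + 1/(1 + n) would lie below y and hence below all of P, against
    -- `q-tight`.
    lower⇒≤ : ∀ {y} → (∀ x → P x → y ≤ x) → ∀ n → y ≤ fromℚ (q n ℚ.+ 1/1+ n)
    lower⇒≤ {y} y≤P n with dec (y ≤ fromℚ (q n ℚ.+ 1/1+ n))
    ... | yes y≤r = y≤r
    ... | no  y≰r = contradiction
      (λ x Px → ≤-trans {fromℚ (q n ℚ.+ 1/1+ n)} {y} {x}
        (≰⇒≥ {y} {fromℚ (q n ℚ.+ 1/1+ n)} y≰r) (y≤P x Px)) (q-tight n)

    infimum-greatest : ∀ y → (∀ x → P x → y ≤ x) → y ≤ infimum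
    infimum-greatest y y≤P ε 0<ε =
      -- The error ε = η + δ + δ is shared out: η for passing from q N to q n, one δ for 1/(1 + N),
      -- and one δ for the real inequality at index n.
      let η , 0<η , η+η≡ε = halve 0<ε
          δ , 0<δ , δ+δ≡η = halve 0<η
          N , small       = 1/1+-small 0<δ
      in eventually-map₂
           (λ {n} y≤ qN≤ → begin
             seq y n                              ≤⟨ y≤ ⟩
             (q N ℚ.+ 1/1+ N) ℚ.+ δ               ≤⟨ ℚ.+-monoˡ-≤ δ (ℚ.+-mono-≤ qN≤ (small N ℕ.≤-refl)) ⟩
             ((q n ℚ.+ η) ℚ.+ δ) ℚ.+ δ            ≡⟨ ℚ.+-assoc (q n ℚ.+ η) δ δ ⟩
             (q n ℚ.+ η) ℚ.+ (δ ℚ.+ δ)            ≡⟨ cong ((q n ℚ.+ η) ℚ.+_) δ+δ≡η ⟩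
             (q n ℚ.+ η) ℚ.+ η                    ≡⟨ ℚ.+-assoc (q n) η η ⟩
             q n ℚ.+ (η ℚ.+ η)                    ≡⟨ cong (q n ℚ.+_) η+η≡ε ⟩
             q n ℚ.+ ε                            ∎)
           (lower⇒≤ {y} y≤P N δ 0<δ) (below⇒eventually-≤ (q-below N) 0<η)
      where open ℚ.≤-Reasoning

  infimum-exists : (P : Pred ℝ (suc 0ℓ)) → (∀ x → P x → 0ℝ ≤ x) → ∃[ ρ ] IsInfimum ⟦ P ⟧ ρ
  infimum-exists P 0≤P with em {∃[ x ] P x}
  -- Everything is a lower bound of the empty set, so its infimum is ∞.
  ... | no ¬P = ⊤⁺ , (λ { [ x ] Px → contradiction (x , Px) ¬P }) , λ l _ → l ≤⊤⁺
  ... | yes (x₀ , Px₀) = [ infimum ] , (λ { [ x ] Px → [ infimum-lower x Px ] }) , greatest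
    where
    open Infimum P 0≤P Px₀
    greatest : ∀ l → IsLowerBound ⟦ P ⟧ l → l ≤∞ [ infimum ]
    greatest [ y ] h = [ infimum-greatest y (λ x Px → Sup.[≤]-injective _≤_ (h [ x ] Px)) ]
    greatest ⊤⁺    h = contradiction (h [ x₀ ] Px₀) λ ()

  -- The ratio of a class as the infimum of its achievable α.

  module _ (C : Pred Instance 0ℓ) where

    Achievable : Pred ℝ (suc 0ℓ)
    Achievable α = ∃[ A ] IsCompetitive C A α

    -- An infimum of infima is the infimum of the union. For `greatest′`, a lower bound of the
    -- ratios reaches an achievable α only through the ratio of its algorithm, which exists by
    -- `infimum-exists`.
    infimum⇒ratio : ∀ {ρ} → IsInfimum ⟦ Achievable ⟧ ρ → IsCompetitiveRatio C ρ
    infimum⇒ratio {ρ} (lower , greatest) = lower′ , greatest′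
      where
      lower′ : IsLowerBound (λ s → ∃[ A ] IsAlgorithmRatio C A s) ρ
      lower′ s (A , _ , s-greatest) = s-greatest ρ λ { [ α ] cα → lower [ α ] (A , cα) }

      greatest′ : ∀ l → IsLowerBound (λ s → ∃[ A ] IsAlgorithmRatio C A s) l → l ≤∞ ρ
      greatest′ l h = greatest l λ { [ α ] (A , cα) →
        let s , s-inf = infimum-exists (IsCompetitive C A)
              (λ x (1≤x , _) → ≤-trans {0ℝ} {1ℝ} {x} (fromℚ-mono 0≤1) 1≤x)
        in Sup.≤⁺-trans _≤_ (λ {x} {y} {z} → ≤-trans {x} {y} {z}) (h s (A , s-inf)) (proj₁ s-inf [ α ] cα) }

-- Lists

module _ {A : Set} where

  ∈-─ : ∀ {xs : List A} {x y} → y ∈ xs → (x∈ : x ∈ xs) → y ≢ x → y ∈ (xs ─ x∈)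
  ∈-─ (here refl) (here refl) y≢x = contradiction refl y≢x
  ∈-─ (here y≡)   (there x∈)  y≢x = here y≡
  ∈-─ (there y∈)  (here _)    y≢x = y∈
  ∈-─ (there y∈)  (there x∈)  y≢x = there (∈-─ y∈ x∈ y≢x)

  -- The pigeonhole principle: the head of xs is deleted from ys, and the other entries survive
  -- there because they differ from it.
  unique-⊆⇒length-≤ : ∀ {xs ys : List A} → Unique xs → xs ⊆ᴸ ys → length xs ℕ.≤ length ys
  unique-⊆⇒length-≤ []           xs⊆ys = ℕ.z≤n
  unique-⊆⇒length-≤ {x ∷ xs} {ys} (x∉xs ∷ u) xs⊆ys =
    subst (ℕ.suc (length xs) ℕ.≤_) (sym (length-removeAt′ ys (index x∈ys)))
      (ℕ.s≤s (unique-⊆⇒length-≤ u λ y∈xs →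
        ∈-─ (xs⊆ys (there y∈xs)) x∈ys λ y≡x → All.lookup x∉xs y∈xs (sym y≡x)))
    where x∈ys = xs⊆ys (here refl)

-- Countable index sets

code : ∀ {κ} → Index κ → ℕ
code {[ n ]} i = toℕ i
code {⊤⁺}    i = i

code-injective : ∀ {κ} {i j : Index κ} → code {κ} i ≡ code {κ} j → i ≡ j
code-injective {[ n ]} = toℕ-injective
code-injective {⊤⁺} eq = eq

code-position : ∀ {κ k} (k≤κ : [ k ] ≤ᶜ κ) i → code {κ} (position k≤κ i) ≡ toℕ i
code-position {[ n ]} [ k≤n ]   i = toℕ-inject≤ i k≤n
code-position {⊤⁺}    (_ ≤⊤⁺)   i = refl

code-< : ∀ {κ} (i : Index κ) → [ ℕ.suc (code {κ} i) ] ≤ᶜ κ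
code-< {[ n ]} i = [ toℕ<n i ]
code-< {⊤⁺}    i = _ ≤⊤⁺

≤ᶜ-down : ∀ {κ k l} → k ℕ.≤ l → [ l ] ≤ᶜ κ → [ k ] ≤ᶜ κ
≤ᶜ-down k≤l l≤κ = Sup.≤⁺-trans ℕ._≤_ ℕ.≤-trans [ k≤l ] l≤κ

finite-or-infinite : ∀ κ → (∃[ n ] [ n ] ≤ᶜ κ × ∀ i → code {κ} i ℕ.< n) ⊎ (∀ k → [ k ] ≤ᶜ κ)
finite-or-infinite [ n ] = inj₁ (n , [ ℕ.≤-refl ] , toℕ<n)
finite-or-infinite ⊤⁺    = inj₂ λ k → [ k ] ≤⊤⁺

⤖-from : {A B : Set} (f : A → B) → (∀ {x y} → f x ≡ f y → x ≡ y) → (∀ y → ∃[ x ] f x ≡ y) → A ⤖ B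
⤖-from f inj surj = mk⤖ (inj , strictlySurjective⇒surjective surj)

-- Consecutive intervals of lengths 1 + s 0, 1 + s 1, …

module Blocks (s : ℕ → ℕ) where

  start : ℕ → ℕ
  start zero      = 0
  start (ℕ.suc b) = start b ℕ.+ ℕ.suc (s b)

  start-mono : ∀ {b c} → b ℕ.≤ c → start b ℕ.≤ start c
  start-mono b≤c = go (ℕ.≤⇒≤′ b≤c)
    where
    go : ∀ {b c} → b ℕ.≤′ c → start b ℕ.≤ start c
    go (ℕ.≤′-reflexive refl) = ℕ.≤-refl
    go (ℕ.≤′-step b≤c) = ℕ.≤-trans (go b≤c) (ℕ.m≤m+n _ _)

  InBlock : ℕ → ℕ → Set
  InBlock b t = start b ℕ.≤ t × t ℕ.< start (ℕ.suc b)

  locate : ∀ t → ∃[ b ] InBlock b t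
  locate zero = 0 , ℕ.z≤n , ℕ.s≤s ℕ.z≤n
  locate (ℕ.suc t) with locate t
  ... | b , b≤t , t<b′ with ℕ.m≤n⇒m<n∨m≡n t<b′
  ...   | inj₁ 1+t<b′ = b , ℕ.m≤n⇒m≤1+n b≤t , 1+t<b′
  -- Here t ends block b, so 1 + t starts the next block, which is nonempty.
  ...   | inj₂ 1+t≡b′ = ℕ.suc b , ℕ.≤-reflexive (sym 1+t≡b′) ,
          subst (ℕ._< start (ℕ.suc (ℕ.suc b))) (sym 1+t≡b′) (ℕ.m<m+n _ (ℕ.s≤s ℕ.z≤n))

  block : ℕ → ℕ
  block t = proj₁ (locate t)

  inBlock-≤ : ∀ {b c t} → InBlock b t → InBlock c t → b ℕ.≤ c
  inBlock-≤ {b} {c} (b≤t , _) (_ , t<c′) with b ℕ.≤? c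
  ... | yes b≤c = b≤c
  ... | no  b≰c = contradiction (ℕ.≤-trans t<c′ (ℕ.≤-trans (start-mono (ℕ.≰⇒> b≰c)) b≤t)) (ℕ.<-irrefl refl)

  block-unique : ∀ {b t} → InBlock b t → block t ≡ b
  block-unique {b} {t} p = ℕ.≤-antisym (inBlock-≤ (proj₂ (locate t)) p) (inBlock-≤ p (proj₂ (locate t)))

  members : ℕ → List ℕ
  members b = applyUpTo (start b ℕ.+_) (ℕ.suc (s b))

  length-members : ∀ b → length (members b) ≡ ℕ.suc (s b)
  length-members b = length-applyUpTo (start b ℕ.+_) (ℕ.suc (s b))

  members-unique : ∀ b → Unique (members b)
  members-unique b = applyUpTo⁺₁ (start b ℕ.+_) (ℕ.suc (s b)) λ i<j _ eq →
    ℕ.<⇒≢ i<j (ℕ.+-cancelˡ-≡ (start b) _ _ eq)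

  ∈-members⁻ : ∀ {b t} → t ∈ members b → block t ≡ b
  ∈-members⁻ {b} t∈ with ∈-applyUpTo⁻ (start b ℕ.+_) t∈
  ... | i , i<1+s , refl = block-unique (ℕ.m≤m+n _ i , ℕ.+-monoʳ-< (start b) i<1+s)

  ∈-members⁺ : ∀ {b t} → block t ≡ b → t ∈ members b
  ∈-members⁺ {b} {t} refl =
    subst (_∈ members b) (ℕ.m+[n∸m]≡n b≤t)
      (∈-applyUpTo⁺ (start b ℕ.+_)
        (ℕ.+-cancelˡ-< (start b) _ _ (subst (ℕ._< start (ℕ.suc b)) (sym (ℕ.m+[n∸m]≡n b≤t)) t<b′)))
    where
    b≤t  = proj₁ (proj₂ (locate t))
    t<b′ = proj₂ (proj₂ (locate t))

-- Fresh elements and padding in an enumerated set.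

module Enumerated (em : ExcludedMiddle (suc 0ℓ)) {E : Set} {κ : Cardinal} (enum : Index κ ⤖ E) where

  open Bijection enum using (to; strictlySurjective) renaming (injective to to-injective)

  all-elements : ∀ k → [ k ] ≤ᶜ κ → FinSubset E
  all-elements k k≤κ = mkFinSubset (tabulate (λ i → to (position k≤κ i)))
    (tabulate⁺ λ eq → position-injective k≤κ (to-injective eq))

  card-all-elements : ∀ k (k≤κ : [ k ] ≤ᶜ κ) → card (all-elements k k≤κ) ≡ k
  card-all-elements k k≤κ = length-tabulate (λ i → to (position k≤κ i))

  -- If xs contained everything, it would contain 1 + length xs distinct elements of the
  -- enumeration.
  fresh : ∀ xs → [ ℕ.suc (length xs) ] ≤ᶜ κ → ∃[ x ] x ∉ xs
  fresh xs <κ with dec em (∃[ x ] x ∉ xs)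
  ... | yes h = h
  ... | no ¬h = contradiction
    (subst (ℕ._≤ length xs) (card-all-elements _ <κ)
      (unique-⊆⇒length-≤ (unique (all-elements _ <κ)) λ {x} _ → decidable-stable (dec em (x ∈ xs)) λ x∉ → ¬h (x , x∉)))
    ℕ.1+n≰n

  -- Padding with fresh elements lets sets of fewer than k elements be compared with Opt(k).
  extend : ∀ k → [ k ] ≤ᶜ κ → (X : FinSubset E) → card X ℕ.≤ k → ∃[ Y ] card Y ≡ k × X ⊆ Y
  extend zero      k≤κ X ≤0 = X , ℕ.n≤0⇒n≡0 ≤0 , id
  extend (ℕ.suc k) k≤κ X ≤1+k with ℕ.m≤n⇒m<n∨m≡n ≤1+k
  ... | inj₂ ≡1+k = X , ≡1+k , id
  ... | inj₁ (ℕ.s≤s ≤k) with extend k (≤ᶜ-down (ℕ.n≤1+n k) k≤κ) X ≤k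
  ...   | Y , refl , X⊆Y with fresh (elems Y) k≤κ
  ...     | y , y∉Y = mkFinSubset (y ∷ elems Y) (¬Any⇒All¬ (elems Y) y∉Y ∷ unique Y) , refl , there ∘ X⊆Y

  all-elements-complete : ∀ {n} (n≤κ : [ n ] ≤ᶜ κ) → (∀ i → code {κ} i ℕ.< n) →
                          ∀ x → x ∈ elems (all-elements n n≤κ)
  all-elements-complete {n} n≤κ code<n x with strictlySurjective x
  ... | i , refl = subst (λ i → to i ∈ elems (all-elements n n≤κ)) position≡i
                     (∈-tabulate⁺ {f = λ j → to (position n≤κ j)} (fromℕ< (code<n i)))
    where
    position≡i : position n≤κ (fromℕ< (code<n i)) ≡ i
    position≡i = code-injective {κ} (trans (code-position n≤κ _) (toℕ-fromℕ< (code<n i)))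

  -- Turning a sequence with repetitions into an order of all elements.

  module Greedy (a : ℕ → E) where

    Missing : List E → Index κ → Set
    Missing xs i = to i ∉ xs

    LeastMissing : List E → Index κ → Set
    LeastMissing xs i = Missing xs i × (∀ j → code {κ} j ℕ.< code {κ} i → to j ∈ xs)

    leastMissing : ∀ xs {x} → x ∉ xs → ∃[ i ] LeastMissing xs i
    leastMissing xs {x} x∉xs with strictlySurjective x
    ... | i , refl = search (ℕ.suc (code {κ} i)) i ℕ.≤-refl x∉xs
      where
      -- The strict bound n on the code is the fuel of a descent to smaller missing indices.
      search : ∀ n i → code {κ} i ℕ.< n → Missing xs i → ∃[ i ] LeastMissing xs i
      search (ℕ.suc n) i (ℕ.s≤s i≤n) i∉ with dec em (∃[ j ] code {κ} j ℕ.< code {κ} i × Missing xs j)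
      ... | yes (j , j<i , j∉) = search n j (ℕ.≤-trans j<i i≤n) j∉
      ... | no ¬h = i , i∉ , λ j j<i → decidable-stable (dec em (to j ∈ xs)) λ j∉ → ¬h (j , j<i , j∉)

    pick : E → List E → E
    pick x xs with dec em (x ∈ xs)
    ... | no _ = x
    ... | yes _ with dec em (∃[ i ] LeastMissing xs i)
    ...   | yes (i , _) = to i
    -- Reached only if `xs` already contains all of `E`, that is, beyond the end of a finite
    -- instance.
    ...   | no _        = x

    pick-∉ : ∀ x xs {y} → y ∉ xs → pick x xs ∉ xs
    pick-∉ x xs y∉ with dec em (x ∈ xs)
    ... | no x∉ = x∉
    ... | yes _ with dec em (∃[ i ] LeastMissing xs i)
    ...   | yes (_ , i∉ , _) = i∉
    ...   | no ¬h            = contradiction (leastMissing xs y∉) ¬h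

    ∈-pick : ∀ x xs → x ∈ pick x xs ∷ xs
    ∈-pick x xs with dec em (x ∈ xs)
    ... | no _ = here refl
    ... | yes x∈ with dec em (∃[ i ] LeastMissing xs i)
    ...   | yes _ = there x∈
    ...   | no _  = there x∈

    pick-spare : ∀ x xs {y} → x ∈ xs → y ∉ xs → ∃[ i ] LeastMissing xs i × pick x xs ≡ to i
    pick-spare x xs x∈ y∉ with dec em (x ∈ xs)
    ... | no x∉ = contradiction x∈ x∉
    ... | yes _ with dec em (∃[ i ] LeastMissing xs i)
    ...   | yes (i , least) = i , least , refl
    ...   | no ¬h           = contradiction (leastMissing xs y∉) ¬h

    chosen : ℕ → List E
    σ : ℕ → E
    chosen zero      = []
    chosen (ℕ.suc t) = σ t ∷ chosen t
    σ t = pick (a t) (chosen t)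

    length-chosen : ∀ t → length (chosen t) ≡ t
    length-chosen zero      = refl
    length-chosen (ℕ.suc t) = cong ℕ.suc (length-chosen t)

    chosen-mono : ∀ {s t} → s ℕ.≤ t → chosen s ⊆ᴸ chosen t
    chosen-mono s≤t = go (ℕ.≤⇒≤′ s≤t)
      where
      go : ∀ {s t} → s ℕ.≤′ t → chosen s ⊆ᴸ chosen t
      go (ℕ.≤′-reflexive refl) x∈ = x∈
      go (ℕ.≤′-step s≤t)       x∈ = there (go s≤t x∈)

    a∈chosen : ∀ t → a t ∈ chosen (ℕ.suc t)
    a∈chosen t = ∈-pick (a t) (chosen t)

    ∈-chosen⁻ : ∀ {x} t → x ∈ chosen t → ∃[ s ] s ℕ.< t × σ s ≡ x
    ∈-chosen⁻ (ℕ.suc t) (here x≡σ) = t , ℕ.≤-refl , sym x≡σ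
    ∈-chosen⁻ (ℕ.suc t) (there x∈) with ∈-chosen⁻ t x∈
    ... | s , s<t , eq = s , ℕ.m≤n⇒m≤1+n s<t , eq

    fresh-chosen : ∀ t → [ ℕ.suc t ] ≤ᶜ κ → ∃[ x ] x ∉ chosen t
    fresh-chosen t <κ = fresh (chosen t) (subst (λ n → [ ℕ.suc n ] ≤ᶜ κ) (sym (length-chosen t)) <κ)

    σ∉chosen : ∀ t → [ ℕ.suc t ] ≤ᶜ κ → σ t ∉ chosen t
    σ∉chosen t <κ = pick-∉ (a t) (chosen t) (proj₂ (fresh-chosen t <κ))

    σ-distinct : ∀ {s t} → s ℕ.< t → [ ℕ.suc t ] ≤ᶜ κ → σ s ≢ σ t
    σ-distinct {s} {t} s<t <κ eq =
      σ∉chosen t <κ (subst (_∈ chosen t) eq (chosen-mono s<t (here refl)))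

    chosen-unique : ∀ t → [ t ] ≤ᶜ κ → Unique (chosen t)
    chosen-unique zero      _  = []
    chosen-unique (ℕ.suc t) <κ =
      ¬Any⇒All¬ (chosen t) (σ∉chosen t <κ) ∷ chosen-unique t (≤ᶜ-down (ℕ.n≤1+n t) <κ)

    order : Index κ → E
    order i = σ (code {κ} i)

    order-injective : ∀ {i j} → order i ≡ order j → i ≡ j
    order-injective {i} {j} eq with ℕ.<-cmp (code {κ} i) (code {κ} j)
    ... | tri< i<j _ _ = contradiction eq (σ-distinct i<j (code-< {κ} j))
    ... | tri≈ _ i≡j _ = code-injective {κ} i≡j
    ... | tri> _ _ j<i = contradiction (sym eq) (σ-distinct j<i (code-< {κ} i))

    order-∈ : ∀ {x t k} → x ∈ chosen t → t ℕ.≤ k → (k≤κ : [ k ] ≤ᶜ κ) → ∃[ i ] order (position k≤κ i) ≡ x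
    order-∈ {x} {t} {k} x∈ t≤k k≤κ with ∈-chosen⁻ t x∈
    ... | s , s<t , refl = i , cong σ (trans (code-position k≤κ i) (toℕ-fromℕ< _))
      where i = fromℕ< (ℕ.≤-trans s<t t≤k)

    module _ (repeats : ∀ t → ∃[ s ] ∃[ t′ ] t ℕ.≤ t′ × s ℕ.< t′ × a s ≡ a t′) where

      module _ (infinite : ∀ k → [ k ] ≤ᶜ κ) where

        -- At a repetition a t′ the step t′ is free, and picks the least missing element.
        initial-segment : ∀ m → ∃[ t ] ∀ i → code {κ} i ℕ.< m → to i ∈ chosen t
        initial-segment zero = 0 , λ _ ()
        initial-segment (ℕ.suc m) with initial-segment m
        ... | t , h with repeats t
        ...   | s , t′ , t≤t′ , s<t′ , as≡at′
              with pick-spare (a t′) (chosen t′)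
                     (subst (_∈ chosen t′) as≡at′ (chosen-mono s<t′ (a∈chosen s)))
                     (proj₂ (fresh-chosen t′ (infinite _)))
        ...     | i , (i∉ , least) , σ≡i = ℕ.suc t′ , covered
          where
          -- All elements of code below m were chosen by time t, so the least missing one has code
          -- at least m. Hence a missing element of code at most m is that least one.
          m≤i : m ℕ.≤ code {κ} i
          m≤i = ℕ.≮⇒≥ λ i<m → i∉ (chosen-mono t≤t′ (h i i<m))

          covered : ∀ j → code {κ} j ℕ.< ℕ.suc m → to j ∈ chosen (ℕ.suc t′)
          covered j (ℕ.s≤s j≤m) with dec em (to j ∈ chosen t′)
          ... | yes j∈ = there j∈
          ... | no  j∉ = here (trans (cong to j≡i) (sym σ≡i))
            where
            j≡i : j ≡ i
            j≡i = code-injective {κ} (ℕ.≤-antisym (ℕ.≤-trans j≤m m≤i) (ℕ.≮⇒≥ λ j<i → j∉ (least j j<i)))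

      -- In the finite case n distinct choices exhaust n elements, by counting. In the infinite case
      -- `initial-segment` reaches the index of x.
      chosen-covers : ∀ x → ∃[ t ] [ t ] ≤ᶜ κ × x ∈ chosen t
      chosen-covers x with finite-or-infinite κ
      ... | inj₁ (n , n≤κ , code<n) = n , n≤κ , decidable-stable (dec em (x ∈ chosen n)) λ x∉ →
              ℕ.1+n≰n (subst₂ ℕ._≤_ (cong ℕ.suc (length-chosen n)) (card-all-elements n n≤κ)
                (unique-⊆⇒length-≤ (¬Any⇒All¬ (chosen n) x∉ ∷ chosen-unique n n≤κ)
                  λ {y} _ → all-elements-complete n≤κ code<n y))
      ... | inj₂ infinite with strictlySurjective x
      ...   | i , refl with initial-segment infinite (ℕ.suc (code {κ} i))
      ...     | t , h = t , infinite t , h i ℕ.≤-refl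

      solution : Index κ ⤖ E
      solution = ⤖-from order order-injective λ x →
        let t , t≤κ , x∈ = chosen-covers x
            i , eq       = order-∈ x∈ ℕ.≤-refl t≤κ
        in position t≤κ i , eq

      a∈prefix : ∀ {t k} → t ℕ.< k → (k≤κ : [ k ] ≤ᶜ κ) →
                 a t ∈ tabulate (λ i → Bijection.to solution (position k≤κ i))
      a∈prefix {t} {k} t<k k≤κ =
        let i , eq = order-∈ (a∈chosen t) t<k k≤κ
        in subst (_∈ tabulate (λ i → order (position k≤κ i))) eq
             (∈-tabulate⁺ {f = λ i → order (position k≤κ i)} i)

-- The separable instance built from a sequence of densities.

-- Block 2 m has 1 + m elements. Every other block is a singleton, so that any
-- enumeration of the blocks repeats itself infinitely often after translation.
excessFrom : ℕ → ℕ → ℕ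
excessFrom m zero                  = m
excessFrom m (ℕ.suc zero)          = 0
excessFrom m (ℕ.suc (ℕ.suc b))     = excessFrom (ℕ.suc m) b

excess : ℕ → ℕ
excess = excessFrom 0

excess-even : ∀ k → excess (k ℕ.* 2) ≡ k
excess-even k = trans (go 0 k) (ℕ.+-identityʳ k)
  where
  go : ∀ m k → excessFrom m (k ℕ.* 2) ≡ k ℕ.+ m
  go m zero      = refl
  go m (ℕ.suc k) = trans (go (ℕ.suc m) k) (ℕ.+-suc k m)

excess-odd : ∀ k → excess (ℕ.suc (k ℕ.* 2)) ≡ 0
excess-odd = go 0
  where
  go : ∀ m k → excessFrom m (ℕ.suc (k ℕ.* 2)) ≡ 0
  go m zero      = refl
  go m (ℕ.suc k) = go (ℕ.suc m) k

open Blocks excess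

-- d m is the density of the blocks with 1 + m elements.
module SeparableFrom (em : ExcludedMiddle (suc 0ℓ)) (d : ℕ → ℝ)
  (0<d       : ∀ m → 0ℝ < d m)
  (d-antitone : ∀ m → d (ℕ.suc m) ≤ d m)
  (d-growth   : ∀ m → fromℕ (ℕ.suc m) * d m ≤ fromℕ (ℕ.suc (ℕ.suc m)) * d (ℕ.suc m))
  where

  value : ℕ → ℝ
  value b = d (excess b)

  0<value : ∀ b → 0ℝ < value b
  0<value b = 0<d (excess b)

  module _ (X : FinSubset ℕ) where

    part : ℕ → List ℕ
    part b = filter (λ t → block t ℕ.≟ b) (elems X)

    count : ℕ → ℕ
    count b = card∩ X block b

    part-unique : ∀ b → Unique (part b)
    part-unique b = filter⁺ (λ t → block t ℕ.≟ b) (unique X)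

    count-≤-size : ∀ b → count b ℕ.≤ ℕ.suc (excess b)
    count-≤-size b = subst (count b ℕ.≤_) (length-members b)
      (unique-⊆⇒length-≤ (part-unique b)
        λ t∈ → ∈-members⁺ (proj₂ (∈-filter⁻ (λ t → block t ℕ.≟ b) {xs = elems X} t∈)))

    count-≤-card : ∀ b → count b ℕ.≤ card X
    count-≤-card b = length-filter (λ t → block t ℕ.≟ b) (elems X)

    worth : ℕ → ℝ
    worth b = fromℕ (count b) * value b

    worth-count : ∀ {b n} → count b ≡ n → worth b ≡ fromℕ n * value b
    worth-count refl = refl

    0≤worth : ∀ b → 0ℝ ≤ worth b
    0≤worth b = 0≤fromℕ* (count b) {value b} (0<value b)

    -- Comparing only the blocks that X meets reduces a maximum over infinitely many parts to one
    -- over a finite list.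
    best : ℕ
    best = proj₁ (maximum-over em worth (map block (elems X)))

    abstract

      objective : ℝ
      objective = worth best

      objective≡worth : objective ≡ worth best
      objective≡worth = refl

    worth-≤-best : ∀ c → worth c ≤ worth best
    worth-≤-best c = cases (c ∈? map block (elems X))
      where
      cases : Dec (c ∈ map block (elems X)) → worth c ≤ worth best
      cases (yes c∈) = proj₂ (maximum-over em worth (map block (elems X))) c c∈
      -- A block that X does not meet is worth 0.
      cases (no c∉)  = ≤-trans {worth c} {0ℝ} {worth best}
        (subst (λ n → fromℕ n * value c ≤ 0ℝ) (sym count≡0)
          (≡-pointwise (fromℕ 0 * value c) 0ℝ (λ k → ℚ.*-zeroˡ (seq (value c) k))))
        (0≤worth best)
        where
        count≡0 : count c ≡ 0
        count≡0 = cong length (filter-none (λ t → block t ℕ.≟ c)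
          (All.tabulate λ {t} t∈ eq → c∉ (subst (_∈ map block (elems X)) eq (∈-map⁺ block t∈))))

    worth-≤ : ∀ c → worth c ≤ objective
    worth-≤ c = subst (worth c ≤_) (sym objective≡worth) (worth-≤-best c)

    objective-≤ : ∀ {x} → (∀ b → worth b ≤ x) → objective ≤ x
    objective-≤ {x} h = subst (_≤ x) (sym objective≡worth) (h best)

    0≤objective : 0ℝ ≤ objective
    0≤objective = subst (0ℝ ≤_) (sym objective≡worth) (0≤worth best)

  count-mono : ∀ {X Y} b → part X b ⊆ᴸ elems Y → count X b ℕ.≤ count Y b
  count-mono {X} {Y} b part⊆ = unique-⊆⇒length-≤ (part-unique X b) λ t∈ →
    ∈-filter⁺ (λ t → block t ℕ.≟ b) (part⊆ t∈) (proj₂ (∈-filter⁻ (λ t → block t ℕ.≟ b) {xs = elems X} t∈))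

  worth-mono : ∀ {X Y b} → count X b ℕ.≤ count Y b → worth X b ≤ objective Y
  worth-mono {X} {Y} {b} c≤ = ≤-trans {worth X b} {worth Y b} {objective Y}
    (fromℕ-*-monoˡ {d = value b} (0<value b) c≤) (worth-≤ Y b)

  objective-mono : ∀ X Y → X ⊆ Y → objective X ≤ objective Y
  objective-mono X Y X⊆Y = objective-≤ X {objective Y} λ b →
    worth-mono {X} {Y} {b} (count-mono {X} {Y} b λ t∈ →
      X⊆Y (proj₁ (∈-filter⁻ (λ t → block t ℕ.≟ b) {xs = elems X} t∈)))

  remove-from-best : ∀ {m} X Y → count X (best X) ≡ ℕ.suc m → count Y (best X) ≡ m →
                     objective X - objective X ÷ ℕ.suc m ≤ objective Y
  remove-from-best {m} X Y X-count Y-count =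
    subst (λ x → x - x ÷ ℕ.suc m ≤ objective Y) (sym (trans (objective≡worth X) (worth-count X X-count)))
      (≤-trans {fromℕ (ℕ.suc m) * value b - (fromℕ (ℕ.suc m) * value b) ÷ ℕ.suc m} {fromℕ m * value b} {objective Y}
        (density-≡ m (value b))
        (subst (_≤ objective Y) (worth-count Y Y-count) (worth-≤ Y b)))
    where b = best X

  -- Removing an element outside the best part costs nothing; if there is none, X
  -- lies in a single part and every element carries an equal share.
  objective-accountable : ∀ X .{{_ : ℕ.NonZero (card X)}} →
    ∃[ e ] ∃[ e∈X ] objective X - objective X ÷ card X ≤ objective (_∖_ X {e} e∈X)
  objective-accountable (mkFinSubset [] _) {{nz}} = contradiction refl (ℕ.≢-nonZero⁻¹ 0 {{nz}})
  objective-accountable X@(mkFinSubset (x ∷ xs) u) = cases (All.all? (λ t → block t ℕ.≟ best X) (x ∷ xs))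
    where
    m = length xs
    Accountable = ∃[ e ] ∃[ e∈X ] objective X - objective X ÷ ℕ.suc m ≤ objective (_∖_ X {e} e∈X)

    uniform : All (λ t → block t ≡ best X) (x ∷ xs) → Accountable
    uniform all-best@(_ ∷ xs-best) = x , here refl ,
      remove-from-best X (X ∖ here refl)
        (cong length (filter-all (λ t → block t ℕ.≟ best X) all-best))
        (cong length (filter-all (λ t → block t ℕ.≟ best X) xs-best))

    mixed : ∃[ e ] e ∈ x ∷ xs × block e ≢ best X → Accountable
    mixed (e , e∈X , e∉best) = e , e∈X ,
      ≤-trans {objective X - objective X ÷ ℕ.suc m} {objective X} {objective X∖e}
        (x-x÷n≤x m {objective X} (0≤objective X))
        (subst (_≤ objective X∖e) (sym (objective≡worth X)) (worth-mono {X} {X∖e} {best X} (count-mono {X} {X∖e} (best X) λ t∈ →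
          let t∈X , t-best = ∈-filter⁻ (λ t → block t ℕ.≟ best X) {xs = elems X} t∈
          in ∈-─ t∈X e∈X λ { refl → e∉best t-best })))
      where X∖e = X ∖ e∈X

    cases : Dec (All (λ t → block t ≡ best X) (x ∷ xs)) → Accountable
    cases (yes all) = uniform all
    cases (no ¬all) = mixed (find (¬All⇒Any¬ (λ t → block t ℕ.≟ best X) (x ∷ xs) ¬all))

  antitone : ∀ {m n} → m ℕ.≤ n → d n ≤ d m
  antitone m≤n = go (ℕ.≤⇒≤′ m≤n)
    where
    go : ∀ {m n} → m ℕ.≤′ n → d n ≤ d m
    go {m} (ℕ.≤′-reflexive refl) = ≤-refl {d m}
    go {m} (ℕ.≤′-step {n} m≤n) = ≤-trans {d (ℕ.suc n)} {d n} {d m} (d-antitone n) (go m≤n)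

  growth : ∀ {m n} → m ℕ.≤ n → fromℕ (ℕ.suc m) * d m ≤ fromℕ (ℕ.suc n) * d n
  growth m≤n = go (ℕ.≤⇒≤′ m≤n)
    where
    g : ℕ → ℝ
    g m = fromℕ (ℕ.suc m) * d m
    go : ∀ {m n} → m ℕ.≤′ n → g m ≤ g n
    go {m} (ℕ.≤′-reflexive refl) = ≤-refl {g m}
    go {m} (ℕ.≤′-step {n} m≤n) = ≤-trans {g m} {g n} {g (ℕ.suc n)} (go m≤n) (d-growth n)

  -- If m ≤ k, the whole block of 1 + m elements is worth no more than one of 1 + k elements, by
  -- growth. If k ≤ m, the c elements are at most 1 + k in number, each of density at most d k.
  -- Hence a full block is an optimum.
  partial-block-≤ : ∀ {c k m} → c ℕ.≤ ℕ.suc k → c ℕ.≤ ℕ.suc m →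
                    fromℕ c * d m ≤ fromℕ (ℕ.suc k) * d k
  partial-block-≤ {c} {k} {m} c≤1+k c≤1+m = [ small , large ]′ (ℕ.≤-total m k)
    where
    small : m ℕ.≤ k → fromℕ c * d m ≤ fromℕ (ℕ.suc k) * d k
    small m≤k = ≤-trans {fromℕ c * d m} {fromℕ (ℕ.suc m) * d m} {fromℕ (ℕ.suc k) * d k}
      (fromℕ-*-monoˡ {d = d m} (0<d m) c≤1+m) (growth m≤k)

    large : k ℕ.≤ m → fromℕ c * d m ≤ fromℕ (ℕ.suc k) * d k
    large k≤m = ≤-trans {fromℕ c * d m} {fromℕ (ℕ.suc k) * d m} {fromℕ (ℕ.suc k) * d k}
      (fromℕ-*-monoˡ {d = d m} (0<d m) c≤1+k) (fromℚ-*-mono (d m) (d k) (0≤ι (ℕ.suc k)) (antitone k≤m))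

  -- The even blocks carry the prescribed sizes; the one of index 2 k has 1 + k elements.
  whole-block : ℕ → FinSubset ℕ
  whole-block k = mkFinSubset (members (k ℕ.* 2)) (members-unique (k ℕ.* 2))

  card-whole-block : ∀ k → card (whole-block k) ≡ ℕ.suc k
  card-whole-block k = trans (length-members (k ℕ.* 2)) (cong ℕ.suc (excess-even k))

  whole-block-≥ : ∀ k → fromℕ (ℕ.suc k) * d k ≤ objective (whole-block k)
  whole-block-≥ k = subst₂ (λ n m → fromℕ n * d m ≤ objective (whole-block k))
    (trans (cong length (filter-all (λ t → block t ℕ.≟ k ℕ.* 2) (All.tabulate ∈-members⁻))) (card-whole-block k))
    (excess-even k)
    (worth-≤ (whole-block k) (k ℕ.* 2))

  objective-optimum : ∀ k → ∃[ O ] IsOptimum objective k O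
  objective-optimum zero = mkFinSubset [] [] , refl ,
    λ { (mkFinSubset [] u) refl → objective-mono (mkFinSubset [] u) (mkFinSubset [] []) id }
  objective-optimum (ℕ.suc k) = whole-block k , card-whole-block k , λ X |X|≡1+k →
    ≤-trans {objective X} {fromℕ (ℕ.suc k) * d k} {objective (whole-block k)}
      (objective-≤ X {fromℕ (ℕ.suc k) * d k} λ b →
        partial-block-≤ {m = excess b} (subst (count X b ℕ.≤_) |X|≡1+k (count-≤-card X b)) (count-≤-size X b))
      (whole-block-≥ k)

  inst : Instance
  inst = record
    { Element     = ℕ
    ; size        = ⊤⁺
    ; enumeration = ⤖-id ℕ
    ; f           = objective
    ; nonNegative = 0≤objective
    ; monotone    = objective-mono
    ; accountable = objective-accountable
    ; optimum     = λ k _ → objective-optimum k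
    }

  separable : Separable inst
  separable = record
    { block      = block
    ; d          = value
    ; d-positive = 0<value
    ; f-upper    = worth-≤
    ; f-attained = λ X → best X , subst (objective X ≈_) (objective≡worth X)
                     (≤-refl {objective X} , ≤-refl {objective X})
    }

-- Bookkeeping for visits to blocks.

-- Finds the time at which the entry of rank j (counted from 0) is taken from block i, so that the
-- matching element is known to be in the translated prefix. The induction shifts g by one; an
-- initial hit lowers the rank by one.
first-hits : (β g : ℕ → ℕ) (i k : ℕ) →
  let hits k = length (filter (λ t → β t ℕ.≟ i) (tabulate {n = k} (g ∘ toℕ))) in
  ∀ j → j ℕ.< hits k → ∃[ l ] l ℕ.< k × β (g l) ≡ i × hits l ≡ j
first-hits β g i (ℕ.suc k) j j<hits = cases j j<hits (β (g 0) ℕ.≟ i)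
  where
  hits : (ℕ → ℕ) → ℕ → ℕ
  hits g k = length (filter (λ t → β t ℕ.≟ i) (tabulate {n = k} (g ∘ toℕ)))

  accept : ∀ k → β (g 0) ≡ i → hits g (ℕ.suc k) ≡ ℕ.suc (hits (g ∘ ℕ.suc) k)
  accept k ≡i = cong length (filter-accept (λ t → β t ℕ.≟ i) {x = g 0} {xs = tabulate {n = k} (g ∘ ℕ.suc ∘ toℕ)} ≡i)

  reject : ∀ k → ¬ β (g 0) ≡ i → hits g (ℕ.suc k) ≡ hits (g ∘ ℕ.suc) k
  reject k ≢i = cong length (filter-reject (λ t → β t ℕ.≟ i) {x = g 0} {xs = tabulate {n = k} (g ∘ ℕ.suc ∘ toℕ)} ≢i)

  cases : ∀ j → j ℕ.< hits g (ℕ.suc k) → Dec (β (g 0) ≡ i) →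
          ∃[ l ] l ℕ.< ℕ.suc k × β (g l) ≡ i × hits g l ≡ j
  cases j j<hits (no ≢i) =
    let l , l<k , hit , eq = first-hits β (g ∘ ℕ.suc) i k j (subst (j ℕ.<_) (reject k ≢i) j<hits)
    in ℕ.suc l , ℕ.s≤s l<k , hit , trans (reject l ≢i) eq
  cases zero      j<hits (yes ≡i) = 0 , ℕ.s≤s ℕ.z≤n , ≡i , refl
  cases (ℕ.suc j) j<hits (yes ≡i) =
    let l , l<k , hit , eq = first-hits β (g ∘ ℕ.suc) i k j
                               (ℕ.s<s⁻¹ (subst (ℕ.suc j ℕ.<_) (accept k ≡i) j<hits))
    in ℕ.suc l , ℕ.s≤s l<k , hit , trans (accept l ≡i) (cong ℕ.suc eq)

bounded-below : (g : ℕ → ℕ) (T : ℕ) → ∃[ M ] ∀ t → t ℕ.< T → g t ℕ.≤ M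
bounded-below g zero = 0 , λ _ ()
bounded-below g (ℕ.suc T) with bounded-below g T
... | M , h = g T ℕ.⊔ M , bound
  where
  bound : ∀ t → t ℕ.< ℕ.suc T → g t ℕ.≤ g T ℕ.⊔ M
  bound t (ℕ.s≤s t≤T) with ℕ.m≤n⇒m<n∨m≡n t≤T
  ... | inj₁ t<T  = ℕ.≤-trans (h t t<T) (ℕ.m≤n⊔m (g T) M)
  ... | inj₂ refl = ℕ.m≤m⊔n (g T) M

n≤start : ∀ n → n ℕ.≤ start n
n≤start zero      = ℕ.z≤n
n≤start (ℕ.suc n) = subst (ℕ._≤ start (ℕ.suc n)) (ℕ.+-comm n 1)
  (ℕ.+-mono-≤ (n≤start n) (ℕ.s≤s (ℕ.z≤n {excess n})))

block-start : ∀ b → block (start b) ≡ b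
block-start b = block-unique (ℕ.≤-refl , ℕ.m<m+n (start b) (ℕ.s≤s ℕ.z≤n))

override : {A : Set} (m : ℕ) → (ℕ → A) → A → ℕ → A
override m o e l with l ℕ.<? m
... | yes _ = o l
... | no  _ = e

override-< : ∀ {A : Set} {m l} {o : ℕ → A} {e} → l ℕ.< m → override m o e l ≡ o l
override-< {m = m} {l} l<m with l ℕ.<? m
... | yes _   = refl
... | no  l≮m = contradiction l<m l≮m

override-≡ : ∀ {A : Set} {m} {o : ℕ → A} {e} → override m o e m ≡ e
override-≡ {m = m} with m ℕ.<? m
... | yes m<m = contradiction m<m (ℕ.<-irrefl refl)
... | no  _   = refl

-- Optimal sets, densities and chains of an arbitrary instance.

module Reduction (em : ExcludedMiddle (suc 0ℓ)) (I : Instance) where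

  open Instance I hiding (Solution; IsCompetitiveSolution)
  open Enumerated em {Element} {size} enumeration

  -- At most k elements rather than exactly k, so that this is meaningful for k beyond the size of a
  -- finite instance.
  IsBest : ℕ → FinSubset Element → Set
  IsBest k O = card O ℕ.≤ k × (∀ X → card X ℕ.≤ k → f X ≤ f O)

  -- Within the size the given optimum works, since smaller sets can be padded; beyond it, the whole
  -- ground set is taken.
  best-subset : ∀ k → ∃[ O ] IsBest k O
  best-subset k = cases (Sup.≤⁺-dec ℕ._≤_ ℕ._≤?_ [ k ] size)
    where
    everything : ¬ [ k ] ≤ᶜ size →
                 (∃[ n ] [ n ] ≤ᶜ size × ∀ i → code {size} i ℕ.< n) ⊎ (∀ k → [ k ] ≤ᶜ size) →
                 ∃[ O ] IsBest k O
    everything k≰κ (inj₁ (n , n≤κ , code<n)) = all-elements n n≤κ ,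
      subst (ℕ._≤ k) (sym (card-all-elements n n≤κ))
        (ℕ.<⇒≤ (ℕ.≰⇒> λ k≤n → k≰κ (≤ᶜ-down k≤n n≤κ))) ,
      λ X _ → monotone X (all-elements n n≤κ) λ {x} _ → all-elements-complete n≤κ code<n x
    everything k≰κ (inj₂ infinite) = contradiction (infinite k) k≰κ

    cases : Dec ([ k ] ≤ᶜ size) → ∃[ O ] IsBest k O
    cases (no k≰κ)  = everything k≰κ (finite-or-infinite size)
    cases (yes k≤κ) =
      let O , |O|≡k , O-optimal = optimum k k≤κ
      in O , ℕ.≤-reflexive |O|≡k , λ X |X|≤k →
           let Y , |Y|≡k , X⊆Y = extend k k≤κ X |X|≤k
           in ≤-trans {f X} {f Y} {f O} (monotone X Y X⊆Y) (O-optimal Y |Y|≡k)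

  O : ℕ → FinSubset Element
  O m = proj₁ (best-subset (ℕ.suc m))

  card-O : ∀ m → card (O m) ℕ.≤ ℕ.suc m
  card-O m = proj₁ (proj₂ (best-subset (ℕ.suc m)))

  v : ℕ → ℝ
  v m = f (O m)

  f≤v : ∀ {m} X → card X ℕ.≤ ℕ.suc m → f X ≤ v m
  f≤v {m} = proj₂ (proj₂ (best-subset (ℕ.suc m)))

  v-mono : ∀ {m n} → m ℕ.≤ n → v m ≤ v n
  v-mono {m} {n} m≤n = f≤v {n} (O m) (ℕ.≤-trans (card-O m) (ℕ.s≤s m≤n))

  d : ℕ → ℝ
  d m = v m ÷ ℕ.suc m

  -- Accountability bounds the loss by f X / (1 + m), and `density-≤` shows that density δ survives
  -- this loss.
  remove : ∀ {m} X {δ} → card X ≡ ℕ.suc m → fromℕ (ℕ.suc m) * δ ≤ f X →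
           ∃[ e ] ∃[ e∈X ] fromℕ m * δ ≤ f (_∖_ X {e} e∈X)
  remove {m} X@(mkFinSubset (_ ∷ _) _) {δ} refl dense =
    let e , e∈X , loss = accountable X
    in e , e∈X , ≤-trans {fromℕ m * δ} {f X - f X ÷ ℕ.suc m} {f (X ∖ e∈X)} (density-≤ m {δ} {f X} dense) loss

  card-∖ : ∀ {m} (X : FinSubset Element) {e} (e∈X : e ∈ elems X) → card X ≡ ℕ.suc m → card (X ∖ e∈X) ≡ m
  card-∖ X e∈X eq = ℕ.suc-injective (trans (sym (length-removeAt′ (elems X) (index e∈X))) eq)

  -- By accountability, removing suitable elements one at a time keeps the density at
  -- least δ, so the last j survivors are worth at least j δ.
  IsChain : ℕ → FinSubset Element → ℝ → (ℕ → Element) → Set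
  IsChain m X δ o = (∀ {x} → x ∈ elems X → ∃[ l ] l ℕ.< m × o l ≡ x) ×
    (∀ j → j ℕ.≤ m → ∀ Y → (∀ l → l ℕ.< j → o l ∈ elems Y) → fromℕ j * δ ≤ f Y)

  module _ (e₀ : Element) where

    -- Induction on the length. For full length, the entries cover X and monotonicity applies;
    -- shorter prefixes are handled by X with one element removed. If X has fewer elements than the
    -- length, X itself serves at the smaller length, as δ is positive.
    chain : ∀ m X {δ} → 0ℝ < δ → card X ℕ.≤ m → fromℕ m * δ ≤ f X → ∃[ o ] IsChain m X δ o
    -- `e₀` is a placeholder: a chain of length 0 imposes no condition on its entries.
    chain zero (mkFinSubset [] _) {δ} 0<δ _ _ = (λ _ → e₀) , (λ ()) , dense
      where
      dense : ∀ j → j ℕ.≤ 0 → ∀ Y → (∀ l → l ℕ.< j → e₀ ∈ elems Y) → fromℕ j * δ ≤ f Y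
      dense .0 ℕ.z≤n Y _ = ≤-trans {fromℕ 0 * δ} {0ℝ} {f Y}
        (≡-pointwise (fromℕ 0 * δ) 0ℝ (λ k → ℚ.*-zeroˡ (seq δ k))) (nonNegative Y)
    chain (ℕ.suc m) X {δ} 0<δ |X|≤1+m X-dense = [ small , full ]′ (ℕ.m≤n⇒m<n∨m≡n |X|≤1+m)
      where
      complete : ∀ o →
        (∀ {x} → x ∈ elems X → ∃[ l ] l ℕ.< ℕ.suc m × o l ≡ x) →
        (∀ j → j ℕ.≤ m → ∀ Y → (∀ l → l ℕ.< j → o l ∈ elems Y) → fromℕ j * δ ≤ f Y) →
        IsChain (ℕ.suc m) X δ o
      complete o covers dense = covers , λ j j≤1+m → [ lower′ j , top j ]′ (ℕ.m≤n⇒m<n∨m≡n j≤1+m)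
        where
        Dense : ℕ → Set
        Dense j = ∀ Y → (∀ l → l ℕ.< j → o l ∈ elems Y) → fromℕ j * δ ≤ f Y

        lower′ : ∀ j → j ℕ.< ℕ.suc m → Dense j
        lower′ j (ℕ.s≤s j≤m) = dense j j≤m

        top : ∀ j → j ≡ ℕ.suc m → Dense j
        top _ refl Y o∈Y = ≤-trans {fromℕ (ℕ.suc m) * δ} {f X} {f Y} X-dense
          (monotone X Y λ x∈ → let l , l<1+m , eq = covers x∈ in subst (_∈ elems Y) eq (o∈Y l l<1+m))

      small : card X ℕ.< ℕ.suc m → ∃[ o ] IsChain (ℕ.suc m) X δ o
      small (ℕ.s≤s |X|≤m) =
        let o , covers , dense = chain m X {δ} 0<δ |X|≤m
              (≤-trans {fromℕ m * δ} {fromℕ (ℕ.suc m) * δ} {f X}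
                (fromℕ-*-monoˡ {m} {ℕ.suc m} {δ} 0<δ (ℕ.n≤1+n m)) X-dense)
        in o , complete o (λ x∈ → let l , l<m , eq = covers x∈ in l , ℕ.m≤n⇒m≤1+n l<m , eq) dense

      full : card X ≡ ℕ.suc m → ∃[ o ] IsChain (ℕ.suc m) X δ o
      full |X|≡1+m = build (remove X {δ} |X|≡1+m X-dense)
        where
        build : ∃[ e ] ∃[ e∈X ] fromℕ m * δ ≤ f (_∖_ X {e} e∈X) → ∃[ o ] IsChain (ℕ.suc m) X δ o
        build (e , e∈X , X∖e-dense) = o , complete o covers′ dense′
          where
          rest = chain m (X ∖ e∈X) {δ} 0<δ (ℕ.≤-reflexive (card-∖ X e∈X |X|≡1+m)) X∖e-dense
          -- The removed element is placed last, so the prefixes of length at most m consist of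
          -- survivors.
          o = override m (proj₁ rest) e
          covers = proj₁ (proj₂ rest)
          dense  = proj₂ (proj₂ rest)

          covers′ : ∀ {x} → x ∈ elems X → ∃[ l ] l ℕ.< ℕ.suc m × o l ≡ x
          covers′ {x} x∈ with dec em (x ≡ e)
          ... | yes refl = m , ℕ.≤-refl , override-≡ {m = m} {o = proj₁ rest}
          ... | no  x≢e =
            let l , l<m , eq = covers (∈-─ x∈ e∈X x≢e)
            in l , ℕ.m≤n⇒m≤1+n l<m , trans (override-< {o = proj₁ rest} l<m) eq

          dense′ : ∀ j → j ℕ.≤ m → ∀ Y → (∀ l → l ℕ.< j → o l ∈ elems Y) → fromℕ j * δ ≤ f Y
          dense′ j j≤m Y o∈Y = dense j j≤m Y λ l l<j →
            subst (_∈ elems Y) (override-< {o = proj₁ rest} (ℕ.≤-trans l<j j≤m)) (o∈Y l l<j)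

    -- The first element of a chain for X alone is worth at least the density of X. So if no set of
    -- at most one element has positive value, neither does any nonempty set.
    0<f⇒0<v₀ : ∀ {m} X → card X ≡ ℕ.suc m → 0ℝ < f X → 0ℝ < v 0
    0<f⇒0<v₀ {m} X |X|≡1+m 0<fX =
      let δ   = f X ÷ ℕ.suc m
          0<δ = 0<÷ m {f X} 0<fX
          o , _ , dense = chain (ℕ.suc m) X {δ} 0<δ (ℕ.≤-reflexive |X|≡1+m) (suc*÷-≤ m (f X))
          Y   = mkFinSubset (o 0 ∷ []) ([] ∷ [])
      in <-≤-trans {0ℝ} {δ} {v 0} 0<δ
           (≤-trans {δ} {fromℕ 1 * δ} {v 0}
             (≡-pointwise δ (fromℕ 1 * δ) (λ k → sym (ℚ.*-identityˡ (seq δ k))))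
             (≤-trans {fromℕ 1 * δ} {f Y} {v 0}
               (dense 1 (ℕ.s≤s ℕ.z≤n) Y λ { zero _ → here refl ; (ℕ.suc _) (ℕ.s≤s ()) })
               (f≤v {0} Y ℕ.≤-refl)))

    module _ (0<v₀ : 0ℝ < v 0) where

      0<d : ∀ m → 0ℝ < d m
      0<d m = 0<÷ m {v m} (<-≤-trans {0ℝ} {v 0} {v m} 0<v₀ (v-mono ℕ.z≤n))

      d-growth : ∀ m → fromℕ (ℕ.suc m) * d m ≤ fromℕ (ℕ.suc (ℕ.suc m)) * d (ℕ.suc m)
      d-growth m = ≤-trans {fromℕ (ℕ.suc m) * d m} {v m} {r} (suc*÷-≤ m (v m))
        (≤-trans {v m} {v (ℕ.suc m)} {r} (v-mono (ℕ.n≤1+n m)) (suc*÷-≥ (ℕ.suc m) (v (ℕ.suc m))))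
        where r = fromℕ (ℕ.suc (ℕ.suc m)) * d (ℕ.suc m)

      -- Removing one element from a best set of 2 + m elements leaves 1 + m elements of density
      -- still at least d (1 + m), and their value is at most v m. If the best set is smaller, v m
      -- bounds its value directly.
      d-antitone : ∀ m → d (ℕ.suc m) ≤ d m
      d-antitone m = fromℕ-*-cancelˡ m {δ} {d m}
        (≤-trans {fromℕ (ℕ.suc m) * δ} {v m} {fromℕ (ℕ.suc m) * d m}
          ([ small , full ]′ (ℕ.m≤n⇒m<n∨m≡n (card-O (ℕ.suc m))))
          (suc*÷-≥ m (v m)))
        where
        X = O (ℕ.suc m)
        δ = d (ℕ.suc m)
        X-dense : fromℕ (ℕ.suc (ℕ.suc m)) * δ ≤ f X
        X-dense = suc*÷-≤ (ℕ.suc m) (f X)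

        small : card X ℕ.< ℕ.suc (ℕ.suc m) → fromℕ (ℕ.suc m) * δ ≤ v m
        small (ℕ.s≤s |X|≤1+m) = ≤-trans {fromℕ (ℕ.suc m) * δ} {fromℕ (ℕ.suc (ℕ.suc m)) * δ} {v m}
          (fromℕ-*-monoˡ {ℕ.suc m} {ℕ.suc (ℕ.suc m)} {δ} (0<d (ℕ.suc m)) (ℕ.n≤1+n (ℕ.suc m)))
          (≤-trans {fromℕ (ℕ.suc (ℕ.suc m)) * δ} {f X} {v m} X-dense (f≤v {m} X |X|≤1+m))

        full : card X ≡ ℕ.suc (ℕ.suc m) → fromℕ (ℕ.suc m) * δ ≤ v m
        full |X|≡2+m =
          let e , e∈X , dense = remove X {δ} |X|≡2+m X-dense
          in ≤-trans {fromℕ (ℕ.suc m) * δ} {f (X ∖ e∈X)} {v m} dense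
               (f≤v {m} (X ∖ e∈X) (ℕ.≤-reflexive (card-∖ X e∈X |X|≡2+m)))

      private module S = SeparableFrom em d 0<d d-antitone d-growth

      abstract
        O-chain : ∀ m → ∃[ o ] IsChain (ℕ.suc m) (O m) (d m) o
        O-chain m = chain (ℕ.suc m) (O m) {d m} (0<d m) (card-O m) (suc*÷-≤ m (v m))

      -- Capping the index at m makes `member 0` constant, so that all singleton blocks translate to
      -- the same element.
      member : ℕ → ℕ → Element
      member m l = proj₁ (O-chain m) (l ℕ.⊓ m)

      member-dense : ∀ m j → j ℕ.≤ ℕ.suc m → ∀ Y → (∀ l → l ℕ.< j → member m l ∈ elems Y) →
                     fromℕ j * d m ≤ f Y
      member-dense m j j≤1+m Y member∈Y = proj₂ (proj₂ (O-chain m)) j j≤1+m Y λ l l<j →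
        subst (λ l → proj₁ (O-chain m) l ∈ elems Y)
          (ℕ.m≤n⇒m⊓n≡m (ℕ.s≤s⁻¹ (ℕ.≤-trans l<j j≤1+m))) (member∈Y l l<j)

      -- Translating a solution of the separable instance.

      module Transfer (τ : ℕ ⤖ ℕ) where

        τ⟨_⟩ : ℕ → ℕ
        τ⟨_⟩ = Bijection.to τ

        earlier : ℕ → ℕ → ℕ
        earlier b k = length (filter (λ t → block t ℕ.≟ b) (tabulate {n = k} (τ⟨_⟩ ∘ toℕ)))

        -- The l-th element that τ takes from a block is replaced by the l-th element of its chain.
        translate : ℕ → Element
        translate t = member (excess b) (earlier b t)
          where b = block τ⟨ t ⟩

        translate-singleton : ∀ t → excess (block τ⟨ t ⟩) ≡ 0 → translate t ≡ member 0 0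
        translate-singleton t eq = trans (cong (λ m → member m l) eq)
          (cong (proj₁ (O-chain 0)) (ℕ.⊓-zeroʳ l))
          where l = earlier (block τ⟨ t ⟩) t

        τ⁻¹ : ∀ x → ∃[ t ] τ⟨ t ⟩ ≡ x
        τ⁻¹ = Bijection.strictlySurjective τ

        repeats : ∀ t → ∃[ s ] ∃[ t′ ] t ℕ.≤ t′ × s ℕ.< t′ × translate s ≡ translate t′
        repeats t =
          s , t′ , ℕ.≤-trans (ℕ.m≤m⊔n t (ℕ.suc s)) T≤t′ , ℕ.≤-trans (ℕ.m≤n⊔m t (ℕ.suc s)) T≤t′ ,
          trans (translate-singleton s (trans (cong (excess ∘ block) τs≡) (trans (cong excess (block-start 1)) (excess-odd 0))))
            (sym (translate-singleton t′ (trans (cong (excess ∘ block) τt′≡) (trans (cong excess (block-start b)) (excess-odd M)))))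
          where
          s    = proj₁ (τ⁻¹ (start 1))
          τs≡  = proj₂ (τ⁻¹ (start 1))
          T    = t ℕ.⊔ ℕ.suc s
          M    = proj₁ (bounded-below τ⟨_⟩ T)
          τ≤M  = proj₂ (bounded-below τ⟨_⟩ T)
          -- Odd blocks are singletons. As start b exceeds M, it is larger than everything τ takes
          -- before T, so τ takes it at a time t′ ≥ T.
          b    = ℕ.suc (M ℕ.* 2)
          t′   = proj₁ (τ⁻¹ (start b))
          τt′≡ = proj₂ (τ⁻¹ (start b))
          M<b : M ℕ.< start b
          M<b = ℕ.≤-trans (ℕ.s≤s (ℕ.m≤m*n M 2)) (n≤start b)
          T≤t′ : T ℕ.≤ t′
          T≤t′ = ℕ.≮⇒≥ λ t′<T → ℕ.<-irrefl refl
            (ℕ.≤-trans M<b (subst (ℕ._≤ M) τt′≡ (τ≤M t′ t′<T)))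

        open Greedy translate using (solution; a∈prefix)

        transferred : Solution I
        transferred = solution repeats

        -- If the prefix of τ takes c elements of a block, the translated prefix contains the first
        -- c elements of the corresponding chain, which are worth at least c times the density. The
        -- maximum over blocks then follows.
        transferred-≥ : ∀ k (k≤κ : [ k ] ≤ᶜ size) →
          S.objective (Instance.prefix S.inst τ k ([ k ] ≤⊤⁺)) ≤ f (prefix transferred k k≤κ)
        transferred-≥ k k≤κ = S.objective-≤ X {f Y} worth-≤-f
          where
          X = Instance.prefix S.inst τ k ([ k ] ≤⊤⁺)
          Y = prefix transferred k k≤κ

          member∈Y : ∀ b l → l ℕ.< earlier b k → member (excess b) l ∈ elems Y
          member∈Y b l l<earlier =
            let t , t<k , hit , earlier≡l = first-hits block τ⟨_⟩ b k l l<earlier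
            in subst (_∈ elems Y)
                 (trans (cong (λ c → member (excess c) (earlier c t)) hit) (cong (member (excess b)) earlier≡l))
                 (a∈prefix repeats t<k k≤κ)

          worth-≤-f : ∀ b → S.worth X b ≤ f Y
          worth-≤-f b = member-dense (excess b) (S.count X b) (S.count-≤-size X b) Y (member∈Y b)

      module _ (A : Algorithm) where

        open Transfer (A S.inst) public

        -- Opt of the instance is at most v k = (1 + k) d k, which the optimum `whole-block k` of
        -- the separable instance attains. Competitiveness there and `transferred-≥` bring the bound
        -- back.
        transferred-competitive : ∀ {α} → 1ℝ ≤ α → IsCompetitiveSolution S.inst α (A S.inst) →
          ∀ k (k≤κ : [ ℕ.suc k ] ≤ᶜ size) → Opt (ℕ.suc k) k≤κ ≤ α * f (prefix transferred (ℕ.suc k) k≤κ)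
        transferred-competitive {α} 1≤α competitive k k≤κ =
          ≤-trans {f X} {v k} {α * y} (f≤v {k} X (ℕ.≤-reflexive (proj₁ (proj₂ (optimum (ℕ.suc k) k≤κ)))))
            (≤-trans {v k} {fromℕ (ℕ.suc k) * d k} {α * y} (suc*÷-≥ k (v k))
              (≤-trans {fromℕ (ℕ.suc k) * d k} {S.objective (S.whole-block k)} {α * y} (S.whole-block-≥ k)
                (≤-trans {S.objective (S.whole-block k)} {α * x} {α * y} (competitive (ℕ.suc k) ([ ℕ.suc k ] ≤⊤⁺))
                  (*-monoʳ-≤ℝ α {x} {y} (1≤⇒eventually {α} 1≤α) (transferred-≥ (ℕ.suc k) k≤κ)))))
          where
          X = proj₁ (optimum (ℕ.suc k) k≤κ)
          x = S.objective (Instance.prefix S.inst (A S.inst) (ℕ.suc k) ([ ℕ.suc k ] ≤⊤⁺))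
          y = f (prefix transferred (ℕ.suc k) k≤κ)

        separable-competitive : ∀ {α} → IsCompetitive IncMaxSep A α → IsCompetitiveSolution S.inst α (A S.inst)
        separable-competitive (_ , competitive) = competitive S.inst S.separable

  module _ (A : Algorithm) where

    -- Exactly what makes all densities positive, as separability demands, and supplies the
    -- placeholder element for chains.
    Nontrivial : Set
    Nontrivial = Element × 0ℝ < v 0

    choose : Dec Nontrivial → Solution I
    choose (yes (e₀ , 0<v₀)) = transferred e₀ 0<v₀ A
    choose (no _)            = enumeration

    f≤α*f : ∀ {α} X → 1ℝ ≤ α → f X ≤ α * f X
    f≤α*f {α} X 1≤α = 1≤α⇒x≤α*x em {α} {f X} 1≤α (nonNegative X)

    choose-competitive : ∀ {α} → IsCompetitive IncMaxSep A α → ∀ c → IsCompetitiveSolution I α (choose c)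
    -- For k = 0 the optimum is the empty set, so monotonicity and α ≥ 1 suffice.
    choose-competitive {α} (1≤α , _) c zero 0≤κ =
      ≤-trans {f X} {f Y} {α * f Y} (monotone X Y (empty X {Y} (proj₁ (proj₂ (optimum 0 0≤κ))))) (f≤α*f {α} Y 1≤α)
      where
      X = proj₁ (optimum 0 0≤κ)
      Y = prefix (choose c) 0 0≤κ
      empty : ∀ X {Y} → card X ≡ 0 → X ⊆ Y
      empty (mkFinSubset [] _) _ ()
    choose-competitive {α} comp@(1≤α , _) (yes (e₀ , 0<v₀)) (ℕ.suc k) k≤κ =
      transferred-competitive e₀ 0<v₀ A {α} 1≤α (separable-competitive e₀ 0<v₀ A {α} comp) k k≤κ
    choose-competitive {α} (1≤α , _) (no trivial) (ℕ.suc k) k≤κ =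
      -- A nonempty set of positive value would make the instance nontrivial, so Opt is at most 0
      -- and any order is competitive.
      ≤-trans {f X} {0ℝ} {α * f Y}
        (≮⇒≥ {f X} λ 0<fX → trivial (e₀ , 0<f⇒0<v₀ e₀ X (proj₁ (proj₂ (optimum (ℕ.suc k) k≤κ))) 0<fX))
        (0≤* α {f Y} (1≤⇒eventually {α} 1≤α) (nonNegative Y))
      where
      X = proj₁ (optimum (ℕ.suc k) k≤κ)
      Y = prefix enumeration (ℕ.suc k) k≤κ
      e₀ = Bijection.to enumeration (position k≤κ Fin.zero)

-- Lifting algorithms and comparing the two classes.

module _ (em : ExcludedMiddle (suc 0ℓ)) where

  -- An algorithm is an arbitrary function on instances, so excluded middle may decide whether an
  -- instance is nontrivial.
  lift-algorithm : Algorithm → Algorithm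
  lift-algorithm A I = choose A (dec em (Nontrivial A))
    where open Reduction em I

  lift-competitive : ∀ {A α} → IsCompetitive IncMaxSep A α → IsCompetitive IncMax (lift-algorithm A) α
  lift-competitive {A} {α} comp = proj₁ comp , λ I _ →
    let open Reduction em I in choose-competitive A {α} comp (dec em (Nontrivial A))

proposition12 : ExcludedMiddle (suc 0ℓ) → ∃[ ρ ] (IsCompetitiveRatio IncMax ρ × IsCompetitiveRatio IncMaxSep ρ)
proposition12 em =
  let ρ , lower , greatest = infimum-exists em (Achievable em IncMax)
        (λ { x (_ , 1≤x , _) → ≤-trans {0ℝ} {1ℝ} {x} (fromℚ-mono 0≤1) 1≤x })
  in ρ , infimum⇒ratio em IncMax (lower , greatest) ,
     infimum⇒ratio em IncMaxSep
       -- Both classes have the same achievable α: algorithms for separable instances are lifted,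
       -- and algorithms for all instances are restricted. So one infimum ρ serves both.
       ( (λ { [ α ] (A , comp) → lower [ α ] (lift-algorithm em A , lift-competitive em {A} {α} comp) })
       , (λ l l-lower → greatest l λ { [ α ] (A , 1≤α , comp) → l-lower [ α ] (A , 1≤α , λ I _ → comp I _) }) )
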